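{- Let $\Sigma$ be a signed graph. Then $\mathsf E(\Sigma,x,y)=\mathsf O(\Sigma,x,y)$ if and only if $\Sigma$ is balanced.
   Context: A signed graph $\Sigma=(\Gamma,\sigma)$ is a finite simple graph $\Gamma$ with a signature $\sigma:E(\Gamma)\to\{\pm1\}$; it is balanced if every cycle has an even number of negative edges. For a finite $C\subseteq\mathbb Z$, a proper $C$-colouring of $\Sigma$ is a map $\kappa:V(\Gamma)\to C$ with $\kappa(v)\ne\sigma(\{v,w\})\kappa(w)$ for every edge $\{v,w\}$. For integers $\lambda\ge\mu\ge0$, a finite $C\subseteq\mathbb Z$ is a $(\lambda,\mu)$-colour set if there are disjoint sets $P,U$ of nonzero integers with $-P=P$, $|U|=\mu$, $(-U)\cap U=\varnothing$, and either $\lambda-\mu$ even, $|P|=\lambda-\mu$, $C=P\cup U$, or $\lambda-\mu$ odd, $|P|=\lambda-\mu-1$, $C=P\cup U\cup\{0\}$. $f(\Sigma,\lambda,\mu)$ is the number of proper $C$-colourings for any $(\lambda,\mu)$-colour set $C$ (independent of $C$). $\mathsf E(\Sigma,x,y),\mathsf O(\Sigma,x,y)\in\mathbb Z[x,y]$ are the unique polynomials with $f(\Sigma,\lambda,\mu)=\mathsf E(\Sigma,\lambda,\mu)$ for all integers $\lambda\ge\mu\ge0$ with $\lambda-\mu$ even and $f(\Sigma,\lambda,\mu)=\mathsf O(\Sigma,\lambda,\mu)$ whenever $\lambda-\mu$ is odd. -}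

module Defs where

open import Data.Bool using (Bool; true; false; not; _∧_)
open import Data.Nat using (ℕ; zero; suc; _≤_; _∸_)
open import Data.Nat.Divisibility using (_∣_)
open import Data.Integer as ℤ using (ℤ; +_; -_; _*_; _+_; _^_)
open import Data.Fin using (Fin)
open import Data.List using (List; []; _∷_; [_]; _++_; length; map; concatMap; filter; allFin)
open import Data.Bool.ListAction using (and)
open import Data.List.Membership.Propositional using (_∈_; _∉_)
open import Data.List.Relation.Unary.All using (All)
open import Data.List.Relation.Unary.Unique.Propositional using (Unique)
open import Data.Vec using (Vec; lookup) renaming ([] to []ᵥ; _∷_ to _∷ᵥ_)
open import Data.Maybe using (Maybe; just; nothing; Is-just)
open import Data.Product using (Σ; _×_; _,_)
open import Data.Sum using (_⊎_)
open import Function.Bundles using (_⇔_)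
open import Relation.Nullary using (¬_; does)
open import Relation.Binary.PropositionalEquality using (_≡_; _≢_)

data Sign : Set where
  plus minus : Sign

_·_ : Sign → ℤ → ℤ
plus  · z = z
minus · z = - z

-- A finite simple signed graph on vertex set Fin n:
-- σ u v = nothing  means u,v not adjacent; σ u v = just s means {u,v} is an
-- edge with sign s.  Symmetric and loopless (simple graph).
record SignedGraph : Set where
  field
    n     : ℕ
    σ     : Fin n → Fin n → Maybe Sign
    σ-sym : ∀ u v → σ u v ≡ σ v u
    σ-irr : ∀ v → σ v v ≡ nothing
open SignedGraph public

consecutive : {A : Set} → List A → List (A × A)
consecutive []           = []
consecutive (x ∷ [])     = []
consecutive (x ∷ y ∷ xs) = (x , y) ∷ consecutive (y ∷ xs)

closedPairs : {A : Set} → List A → List (A × A)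
closedPairs []       = []
closedPairs (x ∷ xs) = consecutive ((x ∷ xs) ++ [ x ])

module _ (S : SignedGraph) where

  isNeg : Fin (n S) × Fin (n S) → Bool
  isNeg (u , v) with σ S u v
  ... | just minus = true
  ... | _          = false

  negCount : List (Fin (n S) × Fin (n S)) → ℕ
  negCount ps = length (filter (λ p → Data.Bool._≟_ (isNeg p) true) ps)

  IsCycle : List (Fin (n S)) → Set
  IsCycle vs = Unique vs × 3 ≤ length vs
             × All (λ p → Is-just (σ S (Data.Product.proj₁ p) (Data.Product.proj₂ p))) (closedPairs vs)

  Balanced : Set
  Balanced = ∀ vs → IsCycle vs → 2 ∣ negCount (closedPairs vs)

  properB : Vec ℤ (n S) → Bool
  properB κ = and (map (λ u → and (map (λ v → ok u v) (allFin (n S)))) (allFin (n S)))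
    where
    ok : Fin (n S) → Fin (n S) → Bool
    ok u v with σ S u v
    ... | nothing = true
    ... | just s  = not (does (lookup κ u ℤ.≟ (s · lookup κ v)))

  -- all maps Fin k → C (C given as a duplicate-free list)
  allVecs : List ℤ → (k : ℕ) → List (Vec ℤ k)
  allVecs C zero    = []ᵥ ∷ []
  allVecs C (suc k) = concatMap (λ c → map (c ∷ᵥ_) (allVecs C k)) C

  numColourings : List ℤ → ℕ
  numColourings C = length (filter (λ κ → Data.Bool._≟_ (properB κ) true) (allVecs C (n S)))

-- (λ,μ)-colour sets; a finite set of integers is a duplicate-free list

IsColourSet : ℕ → ℕ → List ℤ → Set
IsColourSet l m C =
  Unique C × Σ (List ℤ) λ P → Σ (List ℤ) λ U →
    Unique P × Unique U
  × All (λ z → z ≢ + 0) P × All (λ z → z ≢ + 0) U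
  × (∀ z → z ∈ P → z ∉ U)
  × (∀ z → z ∈ P → - z ∈ P)
  × (∀ z → z ∈ U → - z ∉ U)
  × length U ≡ m
  × ((2 ∣ (l ∸ m) × length P ≡ l ∸ m
        × (∀ z → z ∈ C ⇔ (z ∈ P ⊎ z ∈ U)))
    ⊎ (¬ (2 ∣ (l ∸ m)) × length P ≡ l ∸ m ∸ 1
        × (∀ z → z ∈ C ⇔ (z ∈ P ⊎ z ∈ U ⊎ z ≡ + 0))))

-- Polynomials in ℤ[x,y]: p = list of rows, entry (i,j) is the coefficient
-- of x^i y^j; missing entries are 0.

Poly : Set
Poly = List (List ℤ)

nth : List ℤ → ℕ → ℤ
nth []       _       = + 0
nth (c ∷ cs) zero    = c
nth (c ∷ cs) (suc j) = nth cs j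

coeff : Poly → ℕ → ℕ → ℤ
coeff []       _       j = + 0
coeff (r ∷ rs) zero    j = nth r j
coeff (r ∷ rs) (suc i) j = coeff rs i j

_≈P_ : Poly → Poly → Set
p ≈P q = ∀ i j → coeff p i j ≡ coeff q i j

evalRow : List ℤ → ℤ → ℤ
evalRow []       y = + 0
evalRow (c ∷ cs) y = c + y * evalRow cs y

eval : Poly → ℤ → ℤ → ℤ
eval []       x y = + 0
eval (r ∷ rs) x y = evalRow r y + x * eval rs x y

IsEPoly : SignedGraph → Poly → Set
IsEPoly S p = ∀ l m → m ≤ l → 2 ∣ (l ∸ m) → ∀ C → IsColourSet l m C →
              eval p (+ l) (+ m) ≡ + numColourings S C

IsOPoly : SignedGraph → Poly → Set
IsOPoly S p = ∀ l m → m ≤ l → ¬ (2 ∣ (l ∸ m)) → ∀ C → IsColourSet l m C →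
              eval p (+ l) (+ m) ≡ + numColourings S C

{-# OPTIONS --safe #-}
module Submission where

-- Deletion–contraction, carried out for both parities at once on signed graphs whose
-- vertices have restricted domains (C, -C or C ∩ -C, with 0 excluded at a negative
-- loop), gives polynomials for E and O.  A switching function survives contraction and
-- leaves no negative loop, the only place where the parity of λ - μ matters, so E = O
-- for balanced graphs.  Conversely (-1)^n E(-1,0) and (-1)^n O(-1,0) are sums of
-- nonnegative terms along the recursion, a negative loop contributing a factor 1 to
-- the former and 2 to the latter; equality of the two sums therefore yields a
-- switching function.

open import Defs
open import Function.Bundles using (_⇔_; mk⇔; module Equivalence)
open import Data.Bool as Bool using (Bool; true; false; not; _∧_; _∨_; if_then_else_)
import Data.Bool.Properties as Bool
open import Data.Bool.ListAction using (and)
open import Data.Empty using (⊥)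
open import Data.Fin as Fin using (Fin; zero; suc)
open import Data.Integer as ℤ using (ℤ; +_; -[1+_]; -_; _*_; _+_; ∣_∣)
import Data.Integer.Properties as ℤ
open import Data.Integer.Tactic.RingSolver using (solve-∀)
open import Data.List using (List; []; _∷_; [_]; _++_; map; length; filter; concatMap; allFin; cartesianProduct)
open import Data.List.Membership.Propositional using (_∈_; _∉_)
open import Data.List.Membership.Propositional.Properties using (∈-filter⁺; ∈-filter⁻; ∈-allFin; ∈-cartesianProduct⁺)
open import Data.List.Relation.Unary.All as All using (All; []; _∷_)
import Data.List.Relation.Unary.All.Properties as All
open import Data.List.Relation.Unary.AllPairs using ([]; _∷_)
open import Data.List.Relation.Unary.Any as Any using (here; there)
open import Data.List.Relation.Unary.Unique.Propositional using (Unique)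
import Data.List.Relation.Unary.Unique.Propositional.Properties as Unique
open import Data.Maybe using (Maybe; just; nothing; Is-just)
open import Data.Maybe.Properties using (just-injective)
import Data.Maybe.Relation.Unary.Any as Maybe
open import Data.Nat as ℕ using (ℕ; zero; suc; z≤n; s≤s; _<ᵇ_; _∸_)
import Data.Nat.Divisibility as ℕ
import Data.Nat.Properties as ℕ
open import Data.Nat.Tactic.RingSolver using () renaming (solve-∀ to ℕ-solve-∀)
open import Data.Product using (Σ; ∃; _×_; _,_; proj₁; proj₂)
open import Data.Product.Properties using (≡-dec)
open import Data.Sum using (_⊎_; inj₁; inj₂)
open import Data.Unit using (⊤; tt)
open import Data.Vec using (Vec; lookup; tabulate) renaming ([] to []ᵥ; _∷_ to _∷ᵥ_)
open import Data.Vec.Properties using (lookup∘tabulate)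
open import Function using (_∘_)
open import Relation.Binary.Definitions using (DecidableEquality)
open import Relation.Binary.PropositionalEquality hiding ([_])
open import Relation.Nullary using (¬_; Dec; does; yes; no; contradiction)
open import Relation.Nullary.Decidable using (does-⇔; dec-true; dec-false)

-- Contracting an edge of sign s keeps the colourings with κ(v) = sκ(w), so s times the domain of v
-- is imposed on w. Since C need not be closed under negation, C, -C and C ∩ -C all occur, of sizes
-- λ, λ and λ - μ. A negative loop demands κ(v) ≠ -κ(v), that is κ(v) ≠ 0; this costs a colour only
-- if 0 ∈ C, hence only for λ - μ odd.
--
-- The obstacle to the converse is that the recursion alternates, so different contributions of
-- negative loops might cancel. At x = -1 every nonzero domain factor is -1 or -2, and a contraction
-- has one vertex fewer than the deletion, so no two terms have opposite signs. Setting y = 0 erases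
-- the difference between λ and λ - μ, which leaves negative loops as the only source of a factor
-- other than 0 and -1. Terms killed by a positive loop are the other difficulty: they say nothing
-- about negative loops, and parallel edges of equal sign have to be treated apart.
--
-- The given E and O are identified with the recursive polynomials by interpolation, for which
-- explicit colour sets with arbitrarily large λ for each μ ≥ 1 suffice.

private variable
  A B : Set
  ν : ℕ

-- Bivariate polynomials

addRow : List ℤ → List ℤ → List ℤ
addRow []       q        = q
addRow (a ∷ p)  []       = a ∷ p
addRow (a ∷ p)  (b ∷ q)  = a + b ∷ addRow p q

add : Poly → Poly → Poly
add []      q       = q
add (r ∷ p) []      = r ∷ p
add (r ∷ p) (s ∷ q) = addRow r s ∷ add p q

scaleRow : ℤ → List ℤ → List ℤ
scaleRow c []      = []
scaleRow c (a ∷ p) = c * a ∷ scaleRow c p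

scale : ℤ → Poly → Poly
scale c []      = []
scale c (r ∷ p) = scaleRow c r ∷ scale c p

timesY : Poly → Poly
timesY []      = []
timesY (r ∷ p) = (+ 0 ∷ r) ∷ timesY p

-- The number of colours admissible at a vertex is affine in λ and μ, so these are the only factors
-- by which the recursion multiplies.
record Linear : Set where
  constructor _x+_y+_
  field
    xCoeff yCoeff const : ℤ

evalLinear : Linear → ℤ → ℤ → ℤ
evalLinear (a x+ b y+ c) x y = a * x + b * y + c

timesLinear : Linear → Poly → Poly
timesLinear (a x+ b y+ c) p =
  -- Prepending an empty row raises every power of x by one.
  add (scale a ([] ∷ p)) (add (scale b (timesY p)) (scale c p))

nth-addRow : ∀ p q j → nth (addRow p q) j ≡ nth p j + nth q j
nth-addRow []      q       j       = sym (ℤ.+-identityˡ _)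
nth-addRow (a ∷ p) []      j       = sym (ℤ.+-identityʳ _)
nth-addRow (a ∷ p) (b ∷ q) zero    = refl
nth-addRow (a ∷ p) (b ∷ q) (suc j) = nth-addRow p q j

coeff-add : ∀ p q i j → coeff (add p q) i j ≡ coeff p i j + coeff q i j
coeff-add []      q       i       j = sym (ℤ.+-identityˡ _)
coeff-add (r ∷ p) []      i       j = sym (ℤ.+-identityʳ _)
coeff-add (r ∷ p) (s ∷ q) zero    j = nth-addRow r s j
coeff-add (r ∷ p) (s ∷ q) (suc i) j = coeff-add p q i j

nth-scaleRow : ∀ c p j → nth (scaleRow c p) j ≡ c * nth p j
nth-scaleRow c []      j       = sym (ℤ.*-zeroʳ c)
nth-scaleRow c (a ∷ p) zero    = refl
nth-scaleRow c (a ∷ p) (suc j) = nth-scaleRow c p j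

coeff-scale : ∀ c p i j → coeff (scale c p) i j ≡ c * coeff p i j
coeff-scale c []      i       j = sym (ℤ.*-zeroʳ c)
coeff-scale c (r ∷ p) zero    j = nth-scaleRow c r j
coeff-scale c (r ∷ p) (suc i) j = coeff-scale c p i j

private
  horner-+ : ∀ a b y u v → a + b + y * (u + v) ≡ (a + y * u) + (b + y * v)
  horner-+ = solve-∀

  horner-* : ∀ c a y u → c * a + y * (c * u) ≡ c * (a + y * u)
  horner-* = solve-∀

  horner-shift : ∀ x y u v → + 0 + y * u + x * (y * v) ≡ y * (u + x * v)
  horner-shift = solve-∀

evalRow-addRow : ∀ p q y → evalRow (addRow p q) y ≡ evalRow p y + evalRow q y
evalRow-addRow []      q       y = sym (ℤ.+-identityˡ _)
evalRow-addRow (a ∷ p) []      y = sym (ℤ.+-identityʳ _)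
evalRow-addRow (a ∷ p) (b ∷ q) y =
  trans (cong (λ z → a + b + y * z) (evalRow-addRow p q y)) (horner-+ a b y _ _)

eval-add : ∀ p q x y → eval (add p q) x y ≡ eval p x y + eval q x y
eval-add []      q       x y = sym (ℤ.+-identityˡ _)
eval-add (r ∷ p) []      x y = sym (ℤ.+-identityʳ _)
eval-add (r ∷ p) (s ∷ q) x y =
  trans (cong₂ (λ u v → u + x * v) (evalRow-addRow r s y) (eval-add p q x y))
        (horner-+ (evalRow r y) (evalRow s y) x _ _)

evalRow-scaleRow : ∀ c p y → evalRow (scaleRow c p) y ≡ c * evalRow p y
evalRow-scaleRow c []      y = sym (ℤ.*-zeroʳ c)
evalRow-scaleRow c (a ∷ p) y =
  trans (cong (λ z → c * a + y * z) (evalRow-scaleRow c p y)) (horner-* c a y _)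

eval-scale : ∀ c p x y → eval (scale c p) x y ≡ c * eval p x y
eval-scale c []      x y = sym (ℤ.*-zeroʳ c)
eval-scale c (r ∷ p) x y =
  trans (cong₂ (λ u v → u + x * v) (evalRow-scaleRow c r y) (eval-scale c p x y))
        (horner-* c (evalRow r y) x _)

eval-timesY : ∀ p x y → eval (timesY p) x y ≡ y * eval p x y
eval-timesY []      x y = sym (ℤ.*-zeroʳ y)
eval-timesY (r ∷ p) x y =
  trans (cong (λ z → + 0 + y * evalRow r y + x * z) (eval-timesY p x y))
        (horner-shift x y _ _)

eval-timesLinear : ∀ l p x y → eval (timesLinear l p) x y ≡ evalLinear l x y * eval p x y
eval-timesLinear (a x+ b y+ c) p x y = begin
  eval (add (scale a ([] ∷ p)) (add (scale b (timesY p)) (scale c p))) x y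
    ≡⟨ eval-add (scale a ([] ∷ p)) (add (scale b (timesY p)) (scale c p)) x y ⟩
  eval (scale a ([] ∷ p)) x y + eval (add (scale b (timesY p)) (scale c p)) x y
    ≡⟨ cong₂ _+_ (eval-scale a ([] ∷ p) x y) (eval-add (scale b (timesY p)) (scale c p) x y) ⟩
  a * (+ 0 + x * eval p x y) + (eval (scale b (timesY p)) x y + eval (scale c p) x y)
    ≡⟨ cong₂ (λ u v → a * (+ 0 + x * eval p x y) + (u + v))
         (trans (eval-scale b (timesY p) x y) (cong (b *_) (eval-timesY p x y)))
         (eval-scale c p x y) ⟩
  a * (+ 0 + x * eval p x y) + (b * (y * eval p x y) + c * eval p x y)
    ≡⟨ distribute a b c x y (eval p x y) ⟩
  (a * x + b * y + c) * eval p x y ∎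
  where
  open ≡-Reasoning
  distribute : ∀ a b c x y e →
    a * (+ 0 + x * e) + (b * (y * e) + c * e) ≡ (a * x + b * y + c) * e
  distribute = solve-∀

subtract : Poly → Poly → Poly
subtract p q = add p (scale (- + 1) q)

eval-subtract : ∀ p q x y → eval (subtract p q) x y ≡ eval p x y + - + 1 * eval q x y
eval-subtract p q x y =
  trans (eval-add p _ x y) (cong (λ z → eval p x y + z) (eval-scale (- + 1) q x y))

coeff-subtract : ∀ p q i j → coeff (subtract p q) i j ≡ coeff p i j + - + 1 * coeff q i j
coeff-subtract p q i j =
  trans (coeff-add p _ i j) (cong (λ z → coeff p i j + z) (coeff-scale (- + 1) q i j))

≡⇒difference≡0 : ∀ {a b} → a ≡ b → a + - + 1 * b ≡ + 0
≡⇒difference≡0 {a} refl = cancel a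
  where
  cancel : ∀ a → a + - + 1 * a ≡ + 0
  cancel = solve-∀

difference≡0⇒≡ : ∀ {a b} → a + - + 1 * b ≡ + 0 → a ≡ b
difference≡0⇒≡ {a} {b} eq = trans (regroup a b) (trans (cong (λ z → z + b) eq) (ℤ.+-identityˡ b))
  where
  regroup : ∀ a b → a ≡ (a + - + 1 * b) + b
  regroup = solve-∀

-- The constant coefficient of a polynomial vanishing at y is divisible by y, so it
-- is zero once y exceeds it; dividing by y then lowers the degree.
evalRow-vanishing : (point : ℕ → ℕ) → (∀ B → ∃ λ k → B ℕ.< suc (point k)) →
  ∀ r → (∀ k → evalRow r (+ suc (point k)) ≡ + 0) → ∀ j → nth r j ≡ + 0
evalRow-vanishing point unbounded []       vanish j = refl
evalRow-vanishing point unbounded (c ∷ cs) vanish = λ where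
    zero    → c≡0
    (suc j) → evalRow-vanishing point unbounded cs tail-vanish j
  where
  k = proj₁ (unbounded ∣ c ∣)
  y = + suc (point k)

  ∣c∣≡ : ∣ c ∣ ≡ suc (point k) ℕ.* ∣ evalRow cs y ∣
  ∣c∣≡ = trans (cong ∣_∣ (trans (isolate c (y * evalRow cs y)) (cong (λ z → z + - (y * evalRow cs y)) (vanish k))))
         (trans (cong ∣_∣ (ℤ.+-identityˡ (- (y * evalRow cs y))))
         (trans (ℤ.∣-i∣≡∣i∣ (y * evalRow cs y)) (ℤ.abs-* y (evalRow cs y))))
    where
    isolate : ∀ c d → c ≡ c + d + - d
    isolate = solve-∀

  c≡0 : c ≡ + 0
  c≡0 with ∣ c ∣ in eq
  ... | zero  = ℤ.∣i∣≡0⇒i≡0 eq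
  ... | suc n = contradiction (subst (ℕ._< suc (point k)) eq (proj₂ (unbounded ∣ c ∣)))
                  (ℕ.≤⇒≯ (ℕ.∣⇒≤ (ℕ.divides ∣ evalRow cs y ∣ (trans (sym eq) (trans ∣c∣≡ (ℕ.*-comm (suc (point k)) _))))))

  tail-vanish : ∀ k → evalRow cs (+ suc (point k)) ≡ + 0
  tail-vanish k = ℤ.*-cancelˡ-≡ (+ suc (point k)) _ _
    (trans (sym (ℤ.+-identityˡ _))
    (trans (cong (λ z → z + + suc (point k) * evalRow cs (+ suc (point k))) (sym c≡0))
    (trans (vanish k) (sym (ℤ.*-zeroʳ (+ suc (point k)))))))

-- Fixing y leaves a polynomial in x alone, stored as a row so that the one-variable vanishing
-- result applies to it.
evalRows : Poly → ℤ → List ℤ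
evalRows []      y = []
evalRows (r ∷ p) y = evalRow r y ∷ evalRows p y

evalRow-evalRows : ∀ p x y → evalRow (evalRows p y) x ≡ eval p x y
evalRow-evalRows []      x y = refl
evalRow-evalRows (r ∷ p) x y = cong (λ z → evalRow r y + x * z) (evalRow-evalRows p x y)

coeff-vanishing : ∀ p → (∀ y i → nth (evalRows p (+ suc y)) i ≡ + 0) → ∀ i j → coeff p i j ≡ + 0
coeff-vanishing []      vanish i       j = refl
coeff-vanishing (r ∷ p) vanish zero    j =
  evalRow-vanishing (λ y → y) (λ B → B , ℕ.≤-refl) r (λ y → vanish y zero) j
coeff-vanishing (r ∷ p) vanish (suc i) j = coeff-vanishing p (λ y i → vanish y (suc i)) i j

-- For each fixed y the difference has arbitrarily large roots in x, so every row vanishes at that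
-- y; each row then vanishes at all positive y. The points in x may depend on y, which leaves room
-- for λ ≥ μ and for a prescribed parity of λ - μ. Both coordinates are positive because the
-- argument divides by them.
agree⇒≈P : (point : ℕ → ℕ → ℕ) → (∀ m B → ∃ λ k → B ℕ.< suc (point m k)) →
  ∀ p q → (∀ m k → eval p (+ suc (point m k)) (+ suc m) ≡ eval q (+ suc (point m k)) (+ suc m)) →
  p ≈P q
agree⇒≈P point unbounded p q agree i j =
  difference≡0⇒≡ (trans (sym (coeff-subtract p q i j)) (coeff-vanishing (subtract p q) rows i j))
  where
  rows : ∀ m i → nth (evalRows (subtract p q) (+ suc m)) i ≡ + 0
  rows m = evalRow-vanishing (point m) (unbounded m) (evalRows (subtract p q) (+ suc m)) λ k →
    trans (evalRow-evalRows (subtract p q) _ _)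
    (trans (eval-subtract p q _ _) (≡⇒difference≡0 (agree m k)))

evalRow-zero : ∀ r y → (∀ j → nth r j ≡ + 0) → evalRow r y ≡ + 0
evalRow-zero []      y zeros = refl
evalRow-zero (a ∷ r) y zeros =
  cong₂ _+_ (zeros 0) (trans (cong (y *_) (evalRow-zero r y (λ j → zeros (suc j)))) (ℤ.*-zeroʳ y))

eval-zero : ∀ p x y → (∀ i j → coeff p i j ≡ + 0) → eval p x y ≡ + 0
eval-zero []      x y zeros = refl
eval-zero (r ∷ p) x y zeros =
  cong₂ _+_ (evalRow-zero r y (zeros 0))
            (trans (cong (x *_) (eval-zero p x y (λ i → zeros (suc i)))) (ℤ.*-zeroʳ x))

eval-resp-≈P : ∀ p q → p ≈P q → ∀ x y → eval p x y ≡ eval q x y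
eval-resp-≈P p q p≈q x y = difference≡0⇒≡ (trans (sym (eval-subtract p q x y))
  (eval-zero (subtract p q) x y λ i j →
    trans (coeff-subtract p q i j) (≡⇒difference≡0 (p≈q i j))))

-- Deletion–contraction

infixl 7 _⊗_
_⊗_ : Sign → Sign → Sign
plus  ⊗ b     = b
minus ⊗ plus  = minus
minus ⊗ minus = plus

⊗-identityʳ : ∀ a → a ⊗ plus ≡ a
⊗-identityʳ plus  = refl
⊗-identityʳ minus = refl

⊗-comm : ∀ a b → a ⊗ b ≡ b ⊗ a
⊗-comm plus  b     = sym (⊗-identityʳ b)
⊗-comm minus plus  = refl
⊗-comm minus minus = refl

⊗-assoc : ∀ a b c → (a ⊗ b) ⊗ c ≡ a ⊗ (b ⊗ c)
⊗-assoc plus  b     c     = refl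
⊗-assoc minus plus  c     = refl
⊗-assoc minus minus plus  = refl
⊗-assoc minus minus minus = refl

⊗-self : ∀ a → a ⊗ a ≡ plus
⊗-self plus  = refl
⊗-self minus = refl

⊗-cancel : ∀ a b → a ⊗ (a ⊗ b) ≡ b
⊗-cancel a b = trans (sym (⊗-assoc a a b)) (cong (_⊗ b) (⊗-self a))

⊗≡plus⇒≡ : ∀ {a b} → a ⊗ b ≡ plus → a ≡ b
⊗≡plus⇒≡ {plus}          refl = refl
⊗≡plus⇒≡ {minus} {minus} refl = refl

_≟ₛ_ : DecidableEquality Sign
plus  ≟ₛ plus  = yes refl
plus  ≟ₛ minus = no λ ()
minus ≟ₛ plus  = no λ ()
minus ≟ₛ minus = yes refl

-- The colours admissible at a vertex: all of C, all of -C, or C ∩ -C.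
data Shape : Set where
  positive negative symmetric : Shape

_⊓ₛ_ : Shape → Shape → Shape
positive ⊓ₛ positive = positive
negative ⊓ₛ negative = negative
_        ⊓ₛ _        = symmetric

-- ∅ is the domain at a positive loop; the flag marks a negative loop, which excludes 0.
data Domain : Set where
  ∅     : Domain
  ⟨_,_⟩ : Shape → Bool → Domain

_⊓_ : Domain → Domain → Domain
⟨ a , z ⟩ ⊓ ⟨ b , w ⟩ = ⟨ a ⊓ₛ b , z ∨ w ⟩
_         ⊓ _         = ∅

flip : Shape → Shape
flip positive  = negative
flip negative  = positive
flip symmetric = symmetric

_◃_ : Sign → Domain → Domain
minus ◃ ⟨ a , z ⟩ = ⟨ flip a , z ⟩
_     ◃ t         = t

nonzero : Domain → Domain
nonzero ∅         = ∅
nonzero ⟨ a , _ ⟩ = ⟨ a , true ⟩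

Edges : ℕ → Set
Edges n = List (Fin n × Sign)

-- A signed graph on n vertices with a domain at each vertex: the first vertex, its
-- edges to the later vertices, and the system on the later vertices.
data System : ℕ → Set where
  nil  : System 0
  cons : ∀ {n} → Domain → Edges n → System n → System (suc n)

restrict : ∀ {n} → Fin n → Domain → System n → System n
restrict zero    d (cons t es r) = cons (t ⊓ d) es r
restrict (suc j) d (cons t es r) = cons t es (restrict j d r)

addEdge : ∀ {n} → Fin n → Fin n → Sign → System n → System n
addEdge zero    zero    plus  (cons t es r) = cons ∅ es r
addEdge zero    zero    minus (cons t es r) = cons (nonzero t) es r
addEdge zero    (suc j) s     (cons t es r) = cons t ((j , s) ∷ es) r
addEdge (suc i) zero    s     (cons t es r) = cons t ((i , s) ∷ es) r
addEdge (suc i) (suc j) s     (cons t es r) = cons t es (addEdge i j s r)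

addEdges : ∀ {n} → Fin n → Sign → Edges n → System n → System n
addEdges i s []              r = r
addEdges i s ((j , e) ∷ es) r = addEdge i j (s ⊗ e) (addEdges i s es r)

-- Substituting κ(v) = sκ(j) turns κ(v) ≠ eκ(i) into κ(j) ≠ (s ⊗ e)κ(i). A further edge from v to j
-- becomes a loop, positive exactly when its sign is s.
contract : ∀ {n} → Fin n → Sign → Domain → Edges n → System n → System n
contract j s t es r = addEdges j s es (restrict j (s ◃ t) r)

-- The size of the domain: λ for C and -C, λ - μ for C ∩ -C. The constant -1 accounts for the
-- excluded 0, which is a colour only in the odd case.
linear : Bool → Domain → Linear
linear odd ∅                 = (+ 0) x+ (+ 0) y+ (+ 0)
linear odd ⟨ symmetric , z ⟩ = (+ 1) x+ (- + 1) y+ (if odd ∧ z then - + 1 else + 0)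
linear odd ⟨ _ , z ⟩         = (+ 1) x+ (+ 0) y+ (if odd ∧ z then - + 1 else + 0)

poly : Bool → ∀ {n} → System n → Poly
poly odd nil                       = (+ 1 ∷ []) ∷ []
poly odd (cons t []            r) = timesLinear (linear odd t) (poly odd r)
poly odd (cons t ((j , s) ∷ es) r) =
  subtract (poly odd (cons t es r)) (poly odd (contract j s t es r))

weight : Bool → Domain → ℕ
weight odd ∅         = 0
weight odd ⟨ _ , z ⟩ = if odd ∧ z then 2 else 1

-- The polynomial at (-1 , 0) up to sign.
value : Bool → ∀ {n} → System n → ℕ
value odd nil                        = 1
value odd (cons t []             r) = weight odd t ℕ.* value odd r
value odd (cons t ((j , s) ∷ es) r) =
  value odd (cons t es r) ℕ.+ value odd (contract j s t es r)

parity : ℕ → ℤ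
parity zero    = + 1
parity (suc n) = - parity n

parity-cancel : ∀ n a b → parity n * + a ≡ parity n * + b → a ≡ b
parity-cancel zero    a b eq =
  ℤ.+-injective (trans (sym (ℤ.*-identityˡ (+ a))) (trans eq (ℤ.*-identityˡ (+ b))))
parity-cancel (suc n) a b eq = parity-cancel n a b
  (ℤ.neg-injective (trans (ℤ.neg-distribˡ-* (parity n) (+ a))
    (trans eq (sym (ℤ.neg-distribˡ-* (parity n) (+ b))))))

evalLinear-weight : ∀ odd t → evalLinear (linear odd t) (- + 1) (+ 0) ≡ - + weight odd t
evalLinear-weight odd   ∅                     = refl
evalLinear-weight false ⟨ positive  , z ⟩     = refl
evalLinear-weight false ⟨ negative  , z ⟩     = refl
evalLinear-weight false ⟨ symmetric , z ⟩     = refl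
evalLinear-weight true  ⟨ positive  , false ⟩ = refl
evalLinear-weight true  ⟨ positive  , true ⟩  = refl
evalLinear-weight true  ⟨ negative  , false ⟩ = refl
evalLinear-weight true  ⟨ negative  , true ⟩  = refl
evalLinear-weight true  ⟨ symmetric , false ⟩ = refl
evalLinear-weight true  ⟨ symmetric , true ⟩  = refl

-- The contraction has one vertex fewer, hence the opposite `parity`; this turns the subtraction in
-- `poly` into the addition in `value`.
eval-value : ∀ odd {n} (r : System n) →
  eval (poly odd r) (- + 1) (+ 0) ≡ parity n * + value odd r
eval-value odd nil = refl
eval-value odd {suc n} (cons t [] r) =
  trans (eval-timesLinear (linear odd t) (poly odd r) (- + 1) (+ 0))
  (trans (cong₂ _*_ (evalLinear-weight odd t) (eval-value odd r))
  (trans (swap (+ weight odd t) (parity n) (+ value odd r))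
         (cong (- parity n *_) (sym (ℤ.pos-* (weight odd t) (value odd r))))))
  where
  swap : ∀ a b c → (- a) * (b * c) ≡ (- b) * (a * c)
  swap = solve-∀
eval-value odd {suc n} (cons t ((j , s) ∷ es) r) =
  trans (eval-subtract (poly odd (cons t es r)) (poly odd (contract j s t es r)) (- + 1) (+ 0))
  (trans (cong₂ (λ a b → a + - + 1 * b) (eval-value odd (cons t es r))
                                         (eval-value odd (contract j s t es r)))
         (collect (parity n) (+ value odd (cons t es r)) (+ value odd (contract j s t es r))))
  where
  collect : ∀ a b c → (- a) * b + (- + 1) * (a * c) ≡ (- a) * (b + c)
  collect = solve-∀

-- Switching functions under deletion and contraction

Inhabited : Domain → Set
Inhabited ∅         = ⊥
Inhabited ⟨ _ , _ ⟩ = ⊤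

NoPositiveLoop : ∀ {n} → System n → Set
NoPositiveLoop nil           = ⊤
NoPositiveLoop (cons t es r) = Inhabited t × NoPositiveLoop r

-- `∅` passes the test because its factor is 0 for both parities. It must pass: contracting one of
-- two parallel edges of equal sign produces it even when a switching function exists.
NoNegativeLoop : Domain → Set
NoNegativeLoop ∅         = ⊤
NoNegativeLoop ⟨ _ , z ⟩ = z ≡ false

Potential : ∀ {n} → System n → Vec Sign n → Set
Potential nil           []ᵥ      = ⊤
Potential (cons t es r) (a ∷ᵥ τ) =
  NoNegativeLoop t × All (λ (j , s) → s ≡ a ⊗ lookup τ j) es × Potential r τ

⊓-inhabited : ∀ t u → Inhabited t → Inhabited u → Inhabited (t ⊓ u)
⊓-inhabited ⟨ _ , _ ⟩ ⟨ _ , _ ⟩ _ _ = tt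

nonzero-inhabited : ∀ t → Inhabited t → Inhabited (nonzero t)
nonzero-inhabited ⟨ _ , _ ⟩ _ = tt

nonzero-inhabited⁻ : ∀ t → Inhabited (nonzero t) → Inhabited t
nonzero-inhabited⁻ ⟨ _ , _ ⟩ _ = tt

◃-inhabited : ∀ s t → Inhabited t → Inhabited (s ◃ t)
◃-inhabited plus  t         i = i
◃-inhabited minus ⟨ _ , _ ⟩ i = tt

restrict-noPositiveLoop : ∀ {n} j d (r : System n) → Inhabited d →
  NoPositiveLoop r → NoPositiveLoop (restrict j d r)
restrict-noPositiveLoop zero    d (cons t es r) i (p , q) = ⊓-inhabited t d p i , q
restrict-noPositiveLoop (suc j) d (cons t es r) i (p , q) = p , restrict-noPositiveLoop j d r i q

addEdge-noPositiveLoop : ∀ {n} i j s (r : System n) → (i ≡ j → s ≢ plus) →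
  NoPositiveLoop r → NoPositiveLoop (addEdge i j s r)
addEdge-noPositiveLoop zero    zero    plus  (cons t es r) h (p , q) = contradiction refl (h refl)
addEdge-noPositiveLoop zero    zero    minus (cons t es r) h (p , q) = nonzero-inhabited t p , q
addEdge-noPositiveLoop zero    (suc j) s     (cons t es r) h (p , q) = p , q
addEdge-noPositiveLoop (suc i) zero    s     (cons t es r) h (p , q) = p , q
addEdge-noPositiveLoop (suc i) (suc j) s     (cons t es r) h (p , q) =
  p , addEdge-noPositiveLoop i j s r (λ eq → h (cong suc eq)) q

addEdge-noPositiveLoop⁻ : ∀ {n} i j s (r : System n) →
  NoPositiveLoop (addEdge i j s r) → NoPositiveLoop r
addEdge-noPositiveLoop⁻ zero    zero    minus (cons t es r) (p , q) = nonzero-inhabited⁻ t p , q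
addEdge-noPositiveLoop⁻ zero    (suc j) s     (cons t es r) (p , q) = p , q
addEdge-noPositiveLoop⁻ (suc i) zero    s     (cons t es r) (p , q) = p , q
addEdge-noPositiveLoop⁻ (suc i) (suc j) s     (cons t es r) (p , q) =
  p , addEdge-noPositiveLoop⁻ i j s r q

-- An edge `(i , e)` becomes a loop of sign `s ⊗ e`, which is positive only for e = s.
addEdges-noPositiveLoop : ∀ {n} i s es (r : System n) → (i , s) ∉ es →
  NoPositiveLoop r → NoPositiveLoop (addEdges i s es r)
addEdges-noPositiveLoop i s []             r h p = p
addEdges-noPositiveLoop i s ((j , e) ∷ es) r h p =
  addEdge-noPositiveLoop i j (s ⊗ e) (addEdges i s es r)
    (λ i≡j eq → h (here (cong₂ _,_ i≡j (⊗≡plus⇒≡ eq))))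
    (addEdges-noPositiveLoop i s es r (λ m → h (there m)) p)

contract-noPositiveLoop : ∀ {n} j s t es (r : System n) → (j , s) ∉ es →
  NoPositiveLoop (cons t es r) → NoPositiveLoop (contract j s t es r)
contract-noPositiveLoop j s t es r h (p , q) =
  addEdges-noPositiveLoop j s es _ h
    (restrict-noPositiveLoop j (s ◃ t) r (◃-inhabited s t p) q)

⊓-noNegativeLoop : ∀ t u → NoNegativeLoop t → NoNegativeLoop u → NoNegativeLoop (t ⊓ u)
⊓-noNegativeLoop ∅         u         p    q    = tt
⊓-noNegativeLoop ⟨ _ , _ ⟩ ∅         p    q    = tt
⊓-noNegativeLoop ⟨ _ , _ ⟩ ⟨ _ , _ ⟩ refl refl = refl

-- `∅` absorbs the flag of the other argument, so nothing can be read off an empty intersection. For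
-- the same reason the converse lemmas for `restrict`, `addEdge` and `contract` assume
-- `NoPositiveLoop`.
⊓-noNegativeLoop⁻ : ∀ t u → Inhabited (t ⊓ u) → NoNegativeLoop (t ⊓ u) →
  NoNegativeLoop t × NoNegativeLoop u
⊓-noNegativeLoop⁻ ⟨ _ , false ⟩ ⟨ _ , false ⟩ _ _ = refl , refl

◃-noNegativeLoop : ∀ s t → NoNegativeLoop t → NoNegativeLoop (s ◃ t)
◃-noNegativeLoop plus  t         p = p
◃-noNegativeLoop minus ∅         p = p
◃-noNegativeLoop minus ⟨ _ , _ ⟩ p = p

◃-noNegativeLoop⁻ : ∀ s t → NoNegativeLoop (s ◃ t) → NoNegativeLoop t
◃-noNegativeLoop⁻ plus  t         p = p
◃-noNegativeLoop⁻ minus ∅         p = p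
◃-noNegativeLoop⁻ minus ⟨ _ , _ ⟩ p = p

restrict-potential : ∀ {n} j d (r : System n) {τ} → NoNegativeLoop d →
  Potential r τ → Potential (restrict j d r) τ
restrict-potential zero    d (cons t es r) {a ∷ᵥ τ} f (p , q , w) = ⊓-noNegativeLoop t d p f , q , w
restrict-potential (suc j) d (cons t es r) {a ∷ᵥ τ} f (p , q , w) = p , q , restrict-potential j d r f w

restrict-potential⁻ : ∀ {n} j d (r : System n) {τ} → NoPositiveLoop (restrict j d r) →
  Potential (restrict j d r) τ → NoNegativeLoop d × Potential r τ
restrict-potential⁻ zero d (cons t es r) {a ∷ᵥ τ} (i , _) (p , q , w) =
  let pt , pd = ⊓-noNegativeLoop⁻ t d i p in pd , pt , q , w
restrict-potential⁻ (suc j) d (cons t es r) {a ∷ᵥ τ} (_ , i) (p , q , w) =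
  let pd , pr = restrict-potential⁻ j d r i w in pd , p , q , pr

addEdge-potential : ∀ {n} i j s (r : System n) {τ} → s ≡ lookup τ i ⊗ lookup τ j →
  Potential r τ → Potential (addEdge i j s r) τ
addEdge-potential zero    zero    plus  (cons t es r) {a ∷ᵥ τ} eq (p , q , w) = tt , q , w
addEdge-potential zero    zero    minus (cons t es r) {a ∷ᵥ τ} eq (p , q , w) =
  contradiction (trans eq (⊗-self a)) λ ()
addEdge-potential zero    (suc j) s     (cons t es r) {a ∷ᵥ τ} eq (p , q , w) = p , eq ∷ q , w
addEdge-potential (suc i) zero    s     (cons t es r) {a ∷ᵥ τ} eq (p , q , w) =
  p , trans eq (⊗-comm (lookup τ i) a) ∷ q , w
addEdge-potential (suc i) (suc j) s     (cons t es r) {a ∷ᵥ τ} eq (p , q , w) =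
  p , q , addEdge-potential i j s r eq w

addEdge-potential⁻ : ∀ {n} i j s (r : System n) {τ} → NoPositiveLoop (addEdge i j s r) →
  Potential (addEdge i j s r) τ → s ≡ lookup τ i ⊗ lookup τ j × Potential r τ
addEdge-potential⁻ zero    zero    minus (cons ⟨ _ , _ ⟩ es r) {a ∷ᵥ τ} _ (() , _)
addEdge-potential⁻ zero    (suc j) s     (cons t es r) {a ∷ᵥ τ} _ (p , eq ∷ q , w) = eq , p , q , w
addEdge-potential⁻ (suc i) zero    s     (cons t es r) {a ∷ᵥ τ} _ (p , eq ∷ q , w) =
  trans eq (⊗-comm a (lookup τ i)) , p , q , w
addEdge-potential⁻ (suc i) (suc j) s     (cons t es r) {a ∷ᵥ τ} (_ , i′) (p , q , w) =
  let eq , pr = addEdge-potential⁻ i j s r i′ w in eq , p , q , pr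

addEdges-potential : ∀ {n} i s es (r : System n) {τ a} → s ≡ a ⊗ lookup τ i →
  All (λ (j , e) → e ≡ a ⊗ lookup τ j) es → Potential r τ → Potential (addEdges i s es r) τ
addEdges-potential i s []             r         eq []        p = p
addEdges-potential i s ((j , e) ∷ es) r {τ} {a} refl (refl ∷ q) p =
  addEdge-potential i j (s ⊗ e) (addEdges i s es r)
    (trans (cong (_⊗ (a ⊗ lookup τ j)) (⊗-comm a (lookup τ i)))
    (trans (⊗-assoc (lookup τ i) a (a ⊗ lookup τ j))
           (cong (lookup τ i ⊗_) (⊗-cancel a (lookup τ j)))))
    (addEdges-potential i s es r refl q p)

addEdges-potential⁻ : ∀ {n} i s es (r : System n) {τ} → NoPositiveLoop (addEdges i s es r) →
  Potential (addEdges i s es r) τ →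
  All (λ (j , e) → e ≡ (s ⊗ lookup τ i) ⊗ lookup τ j) es × NoPositiveLoop r × Potential r τ
addEdges-potential⁻ i s []             r     l p = [] , l , p
addEdges-potential⁻ i s ((j , e) ∷ es) r {τ} l p =
  let eq , p′      = addEdge-potential⁻ i j (s ⊗ e) (addEdges i s es r) l p
      all , l′ , q = addEdges-potential⁻ i s es r (addEdge-noPositiveLoop⁻ i j (s ⊗ e) _ l) p′
  in trans (sym (⊗-cancel s e))
       (trans (cong (s ⊗_) eq) (sym (⊗-assoc s (lookup τ i) (lookup τ j)))) ∷ all , l′ , q

contract-potential : ∀ {n} j s t es (r : System n) {a τ} →
  Potential (cons t ((j , s) ∷ es) r) (a ∷ᵥ τ) → Potential (contract j s t es r) τ
contract-potential j s t es r (p , eq ∷ q , w) =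
  addEdges-potential j s es _ eq q
    (restrict-potential j (s ◃ t) r (◃-noNegativeLoop s t p) w)

-- The contracted edge forces the sign at the restored vertex: `s ⊗ lookup τ j` is the only a with s
-- = a ⊗ τ(j).
contract-potential⁻ : ∀ {n} j s t es (r : System n) {τ} →
  NoPositiveLoop (contract j s t es r) → Potential (contract j s t es r) τ →
  Potential (cons t ((j , s) ∷ es) r) (s ⊗ lookup τ j ∷ᵥ τ)
contract-potential⁻ j s t es r {τ} l p =
  let q , l′ , p′ = addEdges-potential⁻ j s es (restrict j (s ◃ t) r) l p
      pd , w      = restrict-potential⁻ j (s ◃ t) r l′ p′
  in ◃-noNegativeLoop⁻ s t pd ,
     sym (trans (⊗-assoc s (lookup τ j) (lookup τ j))
         (trans (cong (s ⊗_) (⊗-self (lookup τ j))) (⊗-identityʳ s))) ∷ q ,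
     w

-- Comparing the even and the odd recursion

linear-noNegativeLoop : ∀ t → NoNegativeLoop t → linear true t ≡ linear false t
linear-noNegativeLoop ∅                     _ = refl
linear-noNegativeLoop ⟨ positive  , false ⟩ _ = refl
linear-noNegativeLoop ⟨ negative  , false ⟩ _ = refl
linear-noNegativeLoop ⟨ symmetric , false ⟩ _ = refl

-- A switching function passes to the deletion and to the contraction, so the two recursions run in
-- step and every factor they meet is unflagged or zero. The polynomials agree even as lists.
potential⇒poly≡ : ∀ {n} (r : System n) {τ} → Potential r τ → poly true r ≡ poly false r
potential⇒poly≡ nil {[]ᵥ} _ = refl
potential⇒poly≡ (cons t [] r) {a ∷ᵥ τ} (p , q , w) =
  cong₂ timesLinear (linear-noNegativeLoop t p) (potential⇒poly≡ r w)
potential⇒poly≡ (cons t ((j , s) ∷ es) r) {a ∷ᵥ τ} (p , e ∷ q , w) =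
  cong₂ subtract (potential⇒poly≡ (cons t es r) {a ∷ᵥ τ} (p , q , w))
                 (potential⇒poly≡ (contract j s t es r) (contract-potential j s t es r (p , e ∷ q , w)))

weight-mono : ∀ t → weight false t ℕ.≤ weight true t
weight-mono ∅             = z≤n
weight-mono ⟨ _ , false ⟩ = s≤s z≤n
weight-mono ⟨ _ , true ⟩  = s≤s z≤n

value-mono : ∀ {n} (r : System n) → value false r ℕ.≤ value true r
value-mono nil                        = ℕ.≤-refl
value-mono (cons t []             r) = ℕ.*-mono-≤ (weight-mono t) (value-mono r)
value-mono (cons t ((j , s) ∷ es) r) =
  ℕ.+-mono-≤ (value-mono (cons t es r)) (value-mono (contract j s t es r))

-- Deleting all edges and never contracting yields one summand that is a product of positive
-- weights.
value-positive : ∀ {n} (r : System n) → NoPositiveLoop r → 0 ℕ.< value false r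
value-positive nil                              _       = s≤s z≤n
value-positive (cons ⟨ _ , _ ⟩ []          r) (_ , l) =
  subst (0 ℕ.<_) (sym (ℕ.+-identityʳ _)) (value-positive r l)
value-positive (cons t ((j , s) ∷ es) r) l =
  ℕ.≤-trans (value-positive (cons t es r) l) (ℕ.m≤m+n _ _)

+-squeeze : ∀ {a b c d} → a ℕ.≤ c → b ℕ.≤ d → a ℕ.+ b ≡ c ℕ.+ d → a ≡ c × b ≡ d
+-squeeze {a} {b} {c} {d} a≤c b≤d eq = a≡c , ℕ.+-cancelˡ-≡ c b d (trans (cong (ℕ._+ b) (sym a≡c)) eq)
  where
  a≡c : a ≡ c
  a≡c = ℕ.≤-antisym a≤c (ℕ.+-cancelʳ-≤ d c a (ℕ.≤-trans (ℕ.≤-reflexive (sym eq)) (ℕ.+-monoʳ-≤ a b≤d)))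

-- The potential of the contraction is requested only under `NoPositiveLoop`, since a parallel edge
-- of the same sign puts a positive loop into the contraction and makes its value uninformative.
uncontract-potential : ∀ {n} j s t es (r : System n) → NoPositiveLoop (cons t es r) →
  ∃ (Potential (cons t es r)) →
  (NoPositiveLoop (contract j s t es r) → ∃ (Potential (contract j s t es r))) →
  ∃ (Potential (cons t ((j , s) ∷ es) r))
uncontract-potential j s t es r l (a ∷ᵥ τ , p , q , w) contracted
  with Any.any? (≡-dec Fin._≟_ _≟ₛ_ (j , s)) es
-- The potential of the deletion already satisfies an edge with the same end and sign.
... | yes parallel  = a ∷ᵥ τ , p , All.lookup q parallel ∷ q , w
... | no ¬parallel =
  let l′     = contract-noPositiveLoop j s t es r ¬parallel l
      τ′ , p′ = contracted l′
  in _ , contract-potential⁻ j s t es r l′ p′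

value≡⇒potential : ∀ {n} (r : System n) → NoPositiveLoop r → value false r ≡ value true r →
  ∃ (Potential r)
value≡⇒potential nil _ _ = []ᵥ , tt
value≡⇒potential (cons ⟨ a , false ⟩ [] r) (_ , l) eq =
  let τ , p = value≡⇒potential r l
                (trans (sym (ℕ.+-identityʳ _)) (trans eq (ℕ.+-identityʳ _)))
  in plus ∷ᵥ τ , refl , [] , p
-- The weights are 1 and 2, and the odd value of `r` is positive, so doubling it makes the
-- inequality strict.
value≡⇒potential (cons ⟨ a , true ⟩ [] r) (_ , l) eq = contradiction eq (ℕ.<⇒≢ (begin-strict
  value false r ℕ.+ 0               ≡⟨ ℕ.+-identityʳ _ ⟩
  value false r                     ≤⟨ value-mono r ⟩
  value true r                      <⟨ ℕ.m<m+n (value true r)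
                                         (ℕ.≤-trans (value-positive r l)
                                         (ℕ.≤-trans (value-mono r) (ℕ.m≤m+n _ _))) ⟩
  value true r ℕ.+ (value true r ℕ.+ 0) ∎))
  where open ℕ.≤-Reasoning
value≡⇒potential (cons t ((j , s) ∷ es) r) l eq =
  let eq₁ , eq₂ = +-squeeze (value-mono (cons t es r)) (value-mono (contract j s t es r)) eq
  in uncontract-potential j s t es r l (value≡⇒potential (cons t es r) l eq₁)
       (λ l′ → value≡⇒potential (contract j s t es r) l′ eq₂)

-- Counting proper colourings

∑ : List A → (A → ℕ) → ℕ
∑ []       f = 0
∑ (x ∷ xs) f = f x ℕ.+ ∑ xs f

⟦_⟧ : Bool → ℕ
⟦ true ⟧  = 1
⟦ false ⟧ = 0

∑-cong : ∀ (xs : List A) {f g} → (∀ x → x ∈ xs → f x ≡ g x) → ∑ xs f ≡ ∑ xs g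
∑-cong []       eq = refl
∑-cong (x ∷ xs) eq = cong₂ ℕ._+_ (eq x (here refl)) (∑-cong xs (λ y y∈ → eq y (there y∈)))

∑-+ : ∀ (xs : List A) f g → ∑ xs (λ x → f x ℕ.+ g x) ≡ ∑ xs f ℕ.+ ∑ xs g
∑-+ []       f g = refl
∑-+ (x ∷ xs) f g = trans (cong (f x ℕ.+ g x ℕ.+_) (∑-+ xs f g)) (interchange (f x) (g x) _ _)
  where
  interchange : ∀ a b c d → a ℕ.+ b ℕ.+ (c ℕ.+ d) ≡ a ℕ.+ c ℕ.+ (b ℕ.+ d)
  interchange = ℕ-solve-∀

∑-*ʳ : ∀ (xs : List A) f c → ∑ xs (λ x → f x ℕ.* c) ≡ ∑ xs f ℕ.* c
∑-*ʳ []       f c = refl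
∑-*ʳ (x ∷ xs) f c = trans (cong (f x ℕ.* c ℕ.+_) (∑-*ʳ xs f c)) (sym (ℕ.*-distribʳ-+ c (f x) _))

∑-zero : ∀ (xs : List A) → ∑ xs (λ _ → 0) ≡ 0
∑-zero []       = refl
∑-zero (x ∷ xs) = ∑-zero xs

∑-++ : ∀ (xs ys : List A) f → ∑ (xs ++ ys) f ≡ ∑ xs f ℕ.+ ∑ ys f
∑-++ []       ys f = refl
∑-++ (x ∷ xs) ys f = trans (cong (f x ℕ.+_) (∑-++ xs ys f)) (sym (ℕ.+-assoc (f x) _ _))

∑-map : ∀ (h : A → B) xs f → ∑ (map h xs) f ≡ ∑ xs (f ∘ h)
∑-map h []       f = refl
∑-map h (x ∷ xs) f = cong (f (h x) ℕ.+_) (∑-map h xs f)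

∑-concatMap : ∀ (h : A → List B) xs f → ∑ (concatMap h xs) f ≡ ∑ xs (λ x → ∑ (h x) f)
∑-concatMap h []       f = refl
∑-concatMap h (x ∷ xs) f =
  trans (∑-++ (h x) (concatMap h xs) f) (cong (∑ (h x) f ℕ.+_) (∑-concatMap h xs f))

∑-comm : ∀ (xs : List A) (ys : List B) (f : A → B → ℕ) →
  ∑ xs (λ x → ∑ ys (f x)) ≡ ∑ ys (λ y → ∑ xs (λ x → f x y))
∑-comm []       ys f = sym (∑-zero ys)
∑-comm (x ∷ xs) ys f =
  trans (cong (∑ ys (f x) ℕ.+_) (∑-comm xs ys f)) (sym (∑-+ ys (f x) _))

select : (A → Bool) → List A → List A
select p = filter (λ x → p x Bool.≟ true)

∑-select : ∀ p (xs : List A) f → ∑ (select p xs) f ≡ ∑ xs (λ x → if p x then f x else 0)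
∑-select p []       f = refl
∑-select p (x ∷ xs) f with p x
... | true  = cong (f x ℕ.+_) (∑-select p xs f)
... | false = ∑-select p xs f

length-∑ : ∀ (xs : List A) → length xs ≡ ∑ xs (λ _ → 1)
length-∑ []       = refl
length-∑ (x ∷ xs) = cong suc (length-∑ xs)

if-⟦⟧ : ∀ a b → (if a then ⟦ b ⟧ else 0) ≡ ⟦ a ∧ b ⟧
if-⟦⟧ true  b = refl
if-⟦⟧ false b = refl

length-select : ∀ p (xs : List A) → length (select p xs) ≡ ∑ xs (λ x → ⟦ p x ⟧)
length-select p xs = trans (length-∑ (select p xs)) (trans (∑-select p xs _)
  (∑-cong xs (λ x _ → trans (if-⟦⟧ (p x) true) (cong ⟦_⟧ (Bool.∧-identityʳ (p x))))))

-- The first coordinate is summed innermost: deletion-contraction varies the colour of the first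
-- vertex while those of the later vertices stay fixed.
∑ᵥ : List A → ∀ n → (Vec A n → ℕ) → ℕ
∑ᵥ xs zero    f = f []ᵥ
∑ᵥ xs (suc n) f = ∑ᵥ xs n (λ κ → ∑ xs (λ x → f (x ∷ᵥ κ)))

∑ᵥ-cong : ∀ (xs : List A) n {f g} → (∀ κ → (∀ i → lookup κ i ∈ xs) → f κ ≡ g κ) →
  ∑ᵥ xs n f ≡ ∑ᵥ xs n g
∑ᵥ-cong xs zero    eq = eq []ᵥ (λ ())
∑ᵥ-cong xs (suc n) eq = ∑ᵥ-cong xs n λ κ κ∈ → ∑-cong xs λ x x∈ → eq (x ∷ᵥ κ) λ where
  zero    → x∈
  (suc i) → κ∈ i

∑ᵥ-+ : ∀ (xs : List A) n f g → ∑ᵥ xs n (λ κ → f κ ℕ.+ g κ) ≡ ∑ᵥ xs n f ℕ.+ ∑ᵥ xs n g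
∑ᵥ-+ xs zero    f g = refl
∑ᵥ-+ xs (suc n) f g =
  trans (∑ᵥ-cong xs n (λ κ _ → ∑-+ xs _ _)) (∑ᵥ-+ xs n _ _)

∑ᵥ-*ˡ : ∀ (xs : List A) n c f → ∑ᵥ xs n (λ κ → c ℕ.* f κ) ≡ c ℕ.* ∑ᵥ xs n f
∑ᵥ-*ˡ xs zero    c f = refl
∑ᵥ-*ˡ xs (suc n) c f = trans (∑ᵥ-cong xs n (λ κ _ →
    trans (∑-cong xs (λ x _ → ℕ.*-comm c (f (x ∷ᵥ κ))))
    (trans (∑-*ʳ xs (λ x → f (x ∷ᵥ κ)) c) (ℕ.*-comm _ c))))
  (∑ᵥ-*ˡ xs n c _)

allᵥ : (A → Bool) → Vec A ν → Bool
allᵥ p []ᵥ      = true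
allᵥ p (x ∷ᵥ κ) = p x ∧ allᵥ p κ

∑ᵥ-select : ∀ p (xs : List A) n f →
  ∑ᵥ (select p xs) n f ≡ ∑ᵥ xs n (λ κ → if allᵥ p κ then f κ else 0)
∑ᵥ-select p xs zero    f = refl
∑ᵥ-select p xs (suc n) f = trans (∑ᵥ-select p xs n _) (∑ᵥ-cong xs n λ κ _ → step κ)
  where
  nested : ∀ a b c → (if a then (if b then c else 0) else 0) ≡ (if b ∧ a then c else 0)
  nested true  true  c = refl
  nested true  false c = refl
  nested false true  c = refl
  nested false false c = refl

  pull : ∀ a (g : _ → ℕ) → (if a then ∑ xs g else 0) ≡ ∑ xs (λ x → if a then g x else 0)
  pull true  g = refl
  pull false g = sym (∑-zero xs)

  step : ∀ κ → (if allᵥ p κ then ∑ (select p xs) (λ x → f (x ∷ᵥ κ)) else 0)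
             ≡ ∑ xs (λ x → if p x ∧ allᵥ p κ then f (x ∷ᵥ κ) else 0)
  step κ = trans (cong (if allᵥ p κ then_else 0) (∑-select p xs (λ x → f (x ∷ᵥ κ))))
    (trans (pull (allᵥ p κ) _) (∑-cong xs (λ x _ → nested (allᵥ p κ) (p x) _)))

∑-allVecs : ∀ S C n f → ∑ (allVecs S C n) f ≡ ∑ᵥ C n f
∑-allVecs S C zero    f = ℕ.+-identityʳ (f []ᵥ)
∑-allVecs S C (suc n) f =
  trans (∑-concatMap (λ c → map (c ∷ᵥ_) (allVecs S C n)) C f)
  (trans (∑-cong C (λ c _ → ∑-map (c ∷ᵥ_) (allVecs S C n) f))
  (trans (∑-comm C (allVecs S C n) (λ c κ → f (c ∷ᵥ κ)))
         (∑-allVecs S C n _)))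

-- This is deletion-contraction at one vertex: y is the colour that the new edge forbids. Uniqueness
-- of the list ensures that y is taken out exactly once.
∑-remove : ∀ (xs : List ℤ) {y} (b : ℤ → Bool) → Unique xs → y ∈ xs →
  ∑ xs (λ x → ⟦ b x ⟧) ≡ ∑ xs (λ x → ⟦ not (does (x ℤ.≟ y)) ∧ b x ⟧) ℕ.+ ⟦ b y ⟧
∑-remove (x ∷ xs) b (x∉ ∷ _) (here refl) = trans (ℕ.+-comm ⟦ b x ⟧ _)
  (cong (ℕ._+ ⟦ b x ⟧) (cong₂ ℕ._+_
    (cong (λ d → ⟦ not d ∧ b x ⟧) (sym (dec-true (x ℤ.≟ x) refl)))
    (∑-cong xs λ z z∈ → cong (λ d → ⟦ not d ∧ b z ⟧)
      (sym (dec-false (z ℤ.≟ x) λ z≡x → All.lookup x∉ z∈ (sym z≡x))))))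
∑-remove (x ∷ xs) {y} b (x∉ ∷ u) (there y∈) = trans
  (cong₂ ℕ._+_ (cong (λ d → ⟦ not d ∧ b x ⟧) (sym (dec-false (x ℤ.≟ y) (All.lookup x∉ y∈))))
               (∑-remove xs b u y∈))
  (sym (ℕ.+-assoc ⟦ not (does (x ℤ.≟ y)) ∧ b x ⟧ _ _))

∧-left-comm : ∀ a b c → a ∧ (b ∧ c) ≡ b ∧ (a ∧ c)
∧-left-comm true  b     c = refl
∧-left-comm false true  c = refl
∧-left-comm false false c = refl

·-· : ∀ s e x → s · (e · x) ≡ (s ⊗ e) · x
·-· plus  e     x = refl
·-· minus plus  x = refl
·-· minus minus x = ℤ.neg-involutive x

·-self : ∀ s x → s · (s · x) ≡ x
·-self s x = trans (·-· s s x) (cong (_· x) (⊗-self s))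

differ : ℤ → Sign → ℤ → Bool
differ x s y = not (does (x ℤ.≟ (s · y)))

differ-⇔ : ∀ {x s y x′ s′ y′} → (x ≡ s · y ⇔ x′ ≡ s′ · y′) → differ x s y ≡ differ x′ s′ y′
differ-⇔ {x} {s} {y} {x′} {s′} {y′} eq = cong not (does-⇔ eq (x ℤ.≟ (s · y)) (x′ ℤ.≟ (s′ · y′)))

differ-sym : ∀ x s y → differ x s y ≡ differ y s x
differ-sym x s y = differ-⇔ {x} {s} {y} {y} {s} {x} (mk⇔
  (λ { refl → sym (·-self s y) }) (λ { refl → sym (·-self s x) }))

differ-⊗ : ∀ x s e y → differ x (s ⊗ e) y ≡ differ (s · x) e y
differ-⊗ x s e y = differ-⇔ {x} {s ⊗ e} {y} {s · x} {e} {y} (mk⇔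
  (λ { refl → trans (cong (s ·_) (sym (·-· s e y))) (·-self s (e · y)) })
  (λ eq → trans (sym (·-self s x)) (trans (cong (s ·_) eq) (·-· s e y))))

isZero : ℤ → Bool
isZero x = does (x ℤ.≟ + 0)

differ-minus : ∀ x → differ x minus x ≡ not (isZero x)
differ-minus (+ zero)  = refl
differ-minus (+ suc n) = refl
differ-minus -[1+ n ]  = refl

isZero-neg : ∀ x → isZero (- x) ≡ isZero x
isZero-neg (+ zero)  = refl
isZero-neg (+ suc n) = refl
isZero-neg -[1+ n ]  = refl

allowed : Shape → Bool → Bool → Bool
allowed positive  p q = p
allowed negative  p q = q
allowed symmetric p q = p ∧ q

allowed-⊓ : ∀ a b p q → allowed (a ⊓ₛ b) p q ≡ allowed b p q ∧ allowed a p q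
allowed-⊓ positive  positive  p     q = sym (Bool.∧-idem p)
allowed-⊓ positive  negative  p     q = Bool.∧-comm p q
allowed-⊓ positive  symmetric true  q = sym (Bool.∧-identityʳ q)
allowed-⊓ positive  symmetric false q = refl
allowed-⊓ negative  positive  p     q = refl
allowed-⊓ negative  negative  p     q = sym (Bool.∧-idem q)
allowed-⊓ negative  symmetric p     q = sym (trans (Bool.∧-assoc p q q) (cong (p ∧_) (Bool.∧-idem q)))
allowed-⊓ symmetric positive  true  q = refl
allowed-⊓ symmetric positive  false q = refl
allowed-⊓ symmetric negative  p     q =
  sym (trans (∧-left-comm q p q) (cong (p ∧_) (Bool.∧-idem q)))
allowed-⊓ symmetric symmetric p     q = sym (Bool.∧-idem (p ∧ q))

allowed-flip : ∀ a p q → allowed (flip a) p q ≡ allowed a q p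
allowed-flip positive  p q = refl
allowed-flip negative  p q = refl
allowed-flip symmetric p q = Bool.∧-comm p q

-- Explicit colour sets and the count of their proper colourings

mirrored : ℕ → List ℤ
mirrored zero    = []
mirrored (suc M) = + suc M ∷ -[1+ M ] ∷ mirrored M

∈-mirrored⁻ : ∀ M {x} → x ∈ mirrored M → x ≢ + 0 × ℤ.∣ x ∣ ℕ.≤ M
∈-mirrored⁻ (suc M) (here refl)         = (λ ()) , ℕ.≤-refl
∈-mirrored⁻ (suc M) (there (here refl)) = (λ ()) , ℕ.≤-refl
∈-mirrored⁻ (suc M) (there (there x∈))  =
  let x≢0 , x≤M = ∈-mirrored⁻ M x∈ in x≢0 , ℕ.m≤n⇒m≤1+n x≤M

mirrored-unique : ∀ M → Unique (mirrored M)
mirrored-unique zero    = []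
mirrored-unique (suc M) =
  ((λ ()) ∷ fresh (+ suc M) refl) ∷ fresh -[1+ M ] refl ∷ mirrored-unique M
  where
  fresh : ∀ x → ℤ.∣ x ∣ ≡ suc M → All (x ≢_) (mirrored M)
  fresh x eq = All.tabulate λ { x∈ refl →
    contradiction (ℕ.≤-trans (ℕ.≤-reflexive (sym eq)) (proj₂ (∈-mirrored⁻ M x∈))) (ℕ.<-irrefl refl) }

mirrored-neg : ∀ M {x} → x ∈ mirrored M → - x ∈ mirrored M
mirrored-neg (suc M) (here refl)         = there (here refl)
mirrored-neg (suc M) (there (here refl)) = here refl
mirrored-neg (suc M) (there (there x∈))  = there (there (mirrored-neg M x∈))

ζ : Bool → ℕ
ζ odd = if odd then 1 else 0

zeros : Bool → List ℤ
zeros odd = if odd then + 0 ∷ [] else []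

-- The number of i < M with i < k, which is how many of -1, ..., -M are colours.
below : ℕ → ℕ → ℕ
below k zero    = 0
below k (suc M) = ⟦ M <ᵇ k ⟧ ℕ.+ below k M

<ᵇ-true : ∀ {a b} → a ℕ.< b → (a <ᵇ b) ≡ true
<ᵇ-true {a} {b} a<b with a <ᵇ b | ℕ.<⇒<ᵇ a<b
... | true | _ = refl

<ᵇ-false : ∀ {a b} → b ℕ.≤ a → (a <ᵇ b) ≡ false
<ᵇ-false {a} {b} b≤a with a <ᵇ b in eq
... | false = refl
... | true  = contradiction (ℕ.<ᵇ⇒< a b (subst Bool.T (sym eq) tt)) (ℕ.≤⇒≯ b≤a)

below-≤ : ∀ k M → M ℕ.≤ k → below k M ≡ M
below-≤ k zero    le = refl
below-≤ k (suc M) le = cong₂ ℕ._+_ (cong ⟦_⟧ (<ᵇ-true le)) (below-≤ k M (ℕ.<⇒≤ le))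

below-+ : ∀ k m → below k (m ℕ.+ k) ≡ k
below-+ k zero    = below-≤ k k ℕ.≤-refl
below-+ k (suc m) = cong₂ ℕ._+_ (cong ⟦_⟧ (<ᵇ-false (ℕ.m≤n+m k m))) (below-+ k m)

-- The colour set P ∪ U (∪ {0}) with P = {±1, …, ±k} and U = {k+1, …, k+m}.
module Palette (odd : Bool) (k m : ℕ) where

  -- The set C ∪ -C. Colourings are counted over it, with membership in C left to the domains,
  -- because a contraction needs the range of colours to be closed under negation.
  Ω : List ℤ
  Ω = zeros odd ++ mirrored (m ℕ.+ k)

  -- Membership in C for elements of `Ω` only: the bound m + k on positive colours and the parity
  -- condition on 0 are imposed by `Ω`.
  inC : ℤ → Bool
  inC (+ _)    = true
  inC -[1+ i ] = i <ᵇ k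

  inP inU : ℤ → Bool
  inP x = (inC x ∧ inC (- x)) ∧ not (isZero x)
  inU x = inC x ∧ not (inC (- x))

  C P U : List ℤ
  C = select inC Ω
  P = select inP Ω
  U = select inU Ω

  l : ℕ
  l = m ℕ.+ (ζ odd ℕ.+ (k ℕ.+ k))

  Ω-unique : Unique Ω
  Ω-unique = go odd
    where
    -- The parity becomes an argument so that `zeros o` reduces after a case split.
    go : ∀ o → Unique (zeros o ++ mirrored (m ℕ.+ k))
    go false = mirrored-unique (m ℕ.+ k)
    go true  = All.tabulate (λ x∈ → ≢-sym (proj₁ (∈-mirrored⁻ _ x∈))) ∷ mirrored-unique (m ℕ.+ k)

  Ω-neg : ∀ {x} → x ∈ Ω → - x ∈ Ω
  Ω-neg = go odd
    where
    go : ∀ o {x} → x ∈ zeros o ++ mirrored (m ℕ.+ k) → - x ∈ zeros o ++ mirrored (m ℕ.+ k)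
    go false x∈          = mirrored-neg (m ℕ.+ k) x∈
    go true  (here refl) = here refl
    go true  (there x∈)  = there (mirrored-neg (m ℕ.+ k) x∈)

  Ω-· : ∀ s {x} → x ∈ Ω → s · x ∈ Ω
  Ω-· plus  x∈ = x∈
  Ω-· minus x∈ = Ω-neg x∈

  admits : Domain → ℤ → Bool
  admits ∅         x = false
  admits ⟨ a , z ⟩ x = allowed a (inC x) (inC (- x)) ∧ (not z ∨ not (isZero x))

  admits-⊓ : ∀ t u x → admits (t ⊓ u) x ≡ admits u x ∧ admits t x
  admits-⊓ ∅         ∅         x = refl
  admits-⊓ ∅         ⟨ b , w ⟩ x = sym (Bool.∧-zeroʳ _)
  admits-⊓ ⟨ a , z ⟩ ∅         x = refl
  admits-⊓ ⟨ a , z ⟩ ⟨ b , w ⟩ x = trans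
    (cong (_∧ (not (z ∨ w) ∨ not (isZero x))) (allowed-⊓ a b (inC x) (inC (- x))))
    (regroup (allowed b (inC x) (inC (- x))) (allowed a (inC x) (inC (- x))) z w (not (isZero x)))
    where
    regroup : ∀ p q z w d → (p ∧ q) ∧ (not (z ∨ w) ∨ d) ≡ (p ∧ (not w ∨ d)) ∧ (q ∧ (not z ∨ d))
    regroup false q     z     w     d     = refl
    regroup true  false z     w     d     = sym (Bool.∧-zeroʳ (not w ∨ d))
    regroup true  true  false false d     = refl
    regroup true  true  false true  d     = sym (Bool.∧-identityʳ d)
    regroup true  true  true  false d     = refl
    regroup true  true  true  true  d     = sym (Bool.∧-idem d)

  admits-◃ : ∀ s t x → admits (s ◃ t) x ≡ admits t (s · x)
  admits-◃ plus  t         x = refl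
  admits-◃ minus ∅         x = refl
  admits-◃ minus ⟨ a , z ⟩ x = cong₂ _∧_
    (trans (allowed-flip a (inC x) (inC (- x)))
           (cong (λ y → allowed a (inC (- x)) (inC y)) (sym (ℤ.neg-involutive x))))
    (cong (λ b → not z ∨ not b) (sym (isZero-neg x)))

  admits-nonzero : ∀ t x → admits (nonzero t) x ≡ not (isZero x) ∧ admits t x
  admits-nonzero ∅         x = sym (Bool.∧-zeroʳ _)
  admits-nonzero ⟨ a , z ⟩ x = regroup (allowed a (inC x) (inC (- x))) z (not (isZero x))
    where
    regroup : ∀ p z d → p ∧ d ≡ d ∧ (p ∧ (not z ∨ d))
    regroup p     z     false = Bool.∧-zeroʳ p
    regroup p     false true  = refl
    regroup p     true  true  = refl

  edgesProper : Edges ν → ℤ → Vec ℤ ν → Bool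
  edgesProper []             x κ = true
  edgesProper ((j , s) ∷ es) x κ = differ x s (lookup κ j) ∧ edgesProper es x κ

  proper : System ν → Vec ℤ ν → Bool
  proper nil           κ        = true
  proper (cons t es r) (x ∷ᵥ κ) = admits t x ∧ (edgesProper es x κ ∧ proper r κ)

  proper-restrict : ∀ j d (r : System ν) κ →
    proper (restrict j d r) κ ≡ admits d (lookup κ j) ∧ proper r κ
  proper-restrict zero    d (cons t es r) (x ∷ᵥ κ) =
    trans (cong (_∧ _) (admits-⊓ t d x)) (Bool.∧-assoc (admits d x) (admits t x) _)
  proper-restrict (suc j) d (cons t es r) (x ∷ᵥ κ) =
    trans (cong (λ b → admits t x ∧ (edgesProper es x κ ∧ b)) (proper-restrict j d r κ))
    (trans (cong (admits t x ∧_) (∧-left-comm (edgesProper es x κ) (admits d (lookup κ j)) _))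
           (∧-left-comm (admits t x) (admits d (lookup κ j)) _))

  proper-addEdge : ∀ i j s (r : System ν) κ →
    proper (addEdge i j s r) κ ≡ differ (lookup κ i) s (lookup κ j) ∧ proper r κ
  proper-addEdge zero zero plus (cons t es r) (x ∷ᵥ κ) =
    sym (cong (λ b → not b ∧ proper (cons t es r) (x ∷ᵥ κ)) (dec-true (x ℤ.≟ x) refl))
  proper-addEdge zero zero minus (cons t es r) (x ∷ᵥ κ) =
    trans (cong (_∧ _) (trans (admits-nonzero t x) (cong (_∧ admits t x) (sym (differ-minus x)))))
          (Bool.∧-assoc (differ x minus x) (admits t x) _)
  proper-addEdge zero (suc j) s (cons t es r) (x ∷ᵥ κ) =
    trans (cong (admits t x ∧_) (Bool.∧-assoc (differ x s (lookup κ j)) _ _))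
          (∧-left-comm (admits t x) (differ x s (lookup κ j)) _)
  proper-addEdge (suc i) zero s (cons t es r) (x ∷ᵥ κ) =
    trans (cong (admits t x ∧_) (Bool.∧-assoc (differ x s (lookup κ i)) _ _))
    (trans (∧-left-comm (admits t x) (differ x s (lookup κ i)) _)
           (cong (_∧ _) (differ-sym x s (lookup κ i))))
  proper-addEdge (suc i) (suc j) s (cons t es r) (x ∷ᵥ κ) =
    trans (cong (λ b → admits t x ∧ (edgesProper es x κ ∧ b)) (proper-addEdge i j s r κ))
    (trans (cong (admits t x ∧_) (∧-left-comm (edgesProper es x κ) d _))
           (∧-left-comm (admits t x) d _))
    where
    d = differ (lookup κ i) s (lookup κ j)

  proper-addEdges : ∀ i s es (r : System ν) κ →
    proper (addEdges i s es r) κ ≡ edgesProper es (s · lookup κ i) κ ∧ proper r κ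
  proper-addEdges i s []             r κ = refl
  proper-addEdges i s ((j , e) ∷ es) r κ =
    trans (proper-addEdge i j (s ⊗ e) (addEdges i s es r) κ)
    (trans (cong₂ _∧_ (differ-⊗ (lookup κ i) s e (lookup κ j)) (proper-addEdges i s es r κ))
           (sym (Bool.∧-assoc (differ (s · lookup κ i) e (lookup κ j)) _ _)))

  proper-contract : ∀ j s t es (r : System ν) κ →
    proper (contract j s t es r) κ ≡ proper (cons t es r) (s · lookup κ j ∷ᵥ κ)
  proper-contract j s t es r κ =
    trans (proper-addEdges j s es (restrict j (s ◃ t) r) κ)
    (trans (cong (edgesProper es (s · lookup κ j) κ ∧_)
             (trans (proper-restrict j (s ◃ t) r κ)
                    (cong (_∧ proper r κ) (admits-◃ s t (lookup κ j)))))
           (∧-left-comm (edgesProper es (s · lookup κ j) κ) (admits t (s · lookup κ j)) _))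

  count : System ν → ℕ
  count {n} r = ∑ᵥ Ω n (λ κ → ⟦ proper r κ ⟧)

  ⟦∧⟧ : ∀ a b → ⟦ a ∧ b ⟧ ≡ ⟦ a ⟧ ℕ.* ⟦ b ⟧
  ⟦∧⟧ true  b = sym (ℕ.+-identityʳ ⟦ b ⟧)
  ⟦∧⟧ false b = refl

  size : Domain → ℕ
  size t = ∑ Ω (λ x → ⟦ admits t x ⟧)

  count-isolated : ∀ t (r : System ν) → count (cons t [] r) ≡ size t ℕ.* count r
  count-isolated {n} t r = trans
    (∑ᵥ-cong Ω n λ κ _ → trans (∑-cong Ω λ x _ → ⟦∧⟧ (admits t x) (proper r κ))
                               (∑-*ʳ Ω (λ x → ⟦ admits t x ⟧) ⟦ proper r κ ⟧))
    (∑ᵥ-*ˡ Ω n (size t) (λ κ → ⟦ proper r κ ⟧))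

  -- With the later colours κ fixed, the new edge rules out exactly the colour sκ(j) of the first
  -- vertex, and the colourings using it are those of the contraction. That colour is in the range
  -- of summation because `Ω` is closed under negation.
  count-deletion-contraction : ∀ j s t es (r : System ν) →
    count (cons t es r) ≡ count (cons t ((j , s) ∷ es) r) ℕ.+ count (contract j s t es r)
  count-deletion-contraction {n} j s t es r = trans
    (∑ᵥ-cong Ω n λ κ κ∈ →
      trans (∑-remove Ω {s · lookup κ j} (λ x → proper (cons t es r) (x ∷ᵥ κ)) Ω-unique (Ω-· s (κ∈ j)))
      (cong₂ ℕ._+_
        (∑-cong Ω λ x _ → cong ⟦_⟧
          (trans (∧-left-comm (differ x s (lookup κ j)) (admits t x) _)
                 (cong (admits t x ∧_) (sym (Bool.∧-assoc (differ x s (lookup κ j)) _ _)))))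
        (cong ⟦_⟧ (sym (proper-contract j s t es r κ)))))
    (∑ᵥ-+ Ω n _ _)

  ∑-mirrored : ∀ (f : ℤ → Bool) M → (∀ i → ⟦ f (+ suc i) ⟧ ℕ.+ ⟦ f -[1+ i ] ⟧ ≡ 1 ℕ.+ ⟦ i <ᵇ k ⟧) →
    ∑ (mirrored M) (λ x → ⟦ f x ⟧) ≡ M ℕ.+ below k M
  ∑-mirrored f zero    eq = refl
  ∑-mirrored f (suc M) eq = trans (sym (ℕ.+-assoc ⟦ f (+ suc M) ⟧ ⟦ f -[1+ M ] ⟧ _))
    (trans (cong₂ ℕ._+_ (eq M) (∑-mirrored f M eq)) (regroup ⟦ M <ᵇ k ⟧ M (below k M)))
    where
    regroup : ∀ a b c → 1 ℕ.+ a ℕ.+ (b ℕ.+ c) ≡ suc b ℕ.+ (a ℕ.+ c)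
    regroup = ℕ-solve-∀

  ∑-mirrored-symmetric : ∀ (f : ℤ → Bool) M →
    (∀ i → ⟦ f (+ suc i) ⟧ ℕ.+ ⟦ f -[1+ i ] ⟧ ≡ ⟦ i <ᵇ k ⟧ ℕ.+ ⟦ i <ᵇ k ⟧) →
    ∑ (mirrored M) (λ x → ⟦ f x ⟧) ≡ below k M ℕ.+ below k M
  ∑-mirrored-symmetric f zero    eq = refl
  ∑-mirrored-symmetric f (suc M) eq = trans (sym (ℕ.+-assoc ⟦ f (+ suc M) ⟧ ⟦ f -[1+ M ] ⟧ _))
    (trans (cong₂ ℕ._+_ (eq M) (∑-mirrored-symmetric f M eq)) (regroup ⟦ M <ᵇ k ⟧ (below k M)))
    where
    regroup : ∀ a b → a ℕ.+ a ℕ.+ (b ℕ.+ b) ≡ a ℕ.+ b ℕ.+ (a ℕ.+ b)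
    regroup = ℕ-solve-∀

  extent : Shape → ℕ
  extent symmetric = k ℕ.+ k
  extent _         = m ℕ.+ k ℕ.+ k

  ∑-mirrored-admits : ∀ a z →
    ∑ (mirrored (m ℕ.+ k)) (λ x → ⟦ admits ⟨ a , z ⟩ x ⟧) ≡ extent a
  ∑-mirrored-admits positive z =
    trans (∑-mirrored (admits ⟨ positive , z ⟩) (m ℕ.+ k) (λ i → helper i z))
          (cong (m ℕ.+ k ℕ.+_) (below-+ k m))
    where
    helper : ∀ i z → ⟦ true ∧ (not z ∨ true) ⟧ ℕ.+ ⟦ (i <ᵇ k) ∧ (not z ∨ true) ⟧ ≡ 1 ℕ.+ ⟦ i <ᵇ k ⟧
    helper i z rewrite Bool.∨-zeroʳ (not z) | Bool.∧-identityʳ (i <ᵇ k) = refl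
  ∑-mirrored-admits negative z =
    trans (∑-mirrored (admits ⟨ negative , z ⟩) (m ℕ.+ k) (λ i → helper i z))
          (cong (m ℕ.+ k ℕ.+_) (below-+ k m))
    where
    helper : ∀ i z → ⟦ (i <ᵇ k) ∧ (not z ∨ true) ⟧ ℕ.+ ⟦ true ∧ (not z ∨ true) ⟧ ≡ 1 ℕ.+ ⟦ i <ᵇ k ⟧
    helper i z rewrite Bool.∨-zeroʳ (not z) | Bool.∧-identityʳ (i <ᵇ k) = ℕ.+-comm ⟦ i <ᵇ k ⟧ 1
  ∑-mirrored-admits symmetric z =
    trans (∑-mirrored-symmetric (admits ⟨ symmetric , z ⟩) (m ℕ.+ k) (λ i → helper i z))
          (cong₂ ℕ._+_ (below-+ k m) (below-+ k m))
    where
    helper : ∀ i z → ⟦ (i <ᵇ k) ∧ (not z ∨ true) ⟧ ℕ.+ ⟦ ((i <ᵇ k) ∧ true) ∧ (not z ∨ true) ⟧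
                   ≡ ⟦ i <ᵇ k ⟧ ℕ.+ ⟦ i <ᵇ k ⟧
    helper i z rewrite Bool.∨-zeroʳ (not z) | Bool.∧-identityʳ (i <ᵇ k) | Bool.∧-identityʳ (i <ᵇ k) = refl

  size-⟨⟩ : ∀ a z → size ⟨ a , z ⟩ ≡ ζ (odd ∧ not z) ℕ.+ extent a
  size-⟨⟩ a z = go odd a z
    where
    go : ∀ o a z → ∑ (zeros o ++ mirrored (m ℕ.+ k)) (λ x → ⟦ admits ⟨ a , z ⟩ x ⟧)
                 ≡ ζ (o ∧ not z) ℕ.+ extent a
    go false a         z     = ∑-mirrored-admits a z
    go true  positive  false = cong suc (∑-mirrored-admits positive false)
    go true  positive  true  = ∑-mirrored-admits positive true
    go true  negative  false = cong suc (∑-mirrored-admits negative false)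
    go true  negative  true  = ∑-mirrored-admits negative true
    go true  symmetric false = cong suc (∑-mirrored-admits symmetric false)
    go true  symmetric true  = ∑-mirrored-admits symmetric true

  evalLinear-size : ∀ t → evalLinear (linear odd t) (+ l) (+ m) ≡ + size t
  evalLinear-size ∅         = cong +_ (sym (∑-zero Ω))
  evalLinear-size ⟨ a , z ⟩ = trans (go odd a z) (cong +_ (sym (size-⟨⟩ a z)))
    where
    one-sided : ∀ m k c d e → c + d ≡ e →
      + 1 * (m + (c + (k + k))) + + 0 * m + d ≡ e + (m + k + k)
    one-sided m k c d .(c + d) refl = regroup m k c d
      where
      regroup : ∀ m k c d → + 1 * (m + (c + (k + k))) + + 0 * m + d ≡ c + d + (m + k + k)
      regroup = solve-∀

    two-sided : ∀ m k c d e → c + d ≡ e →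
      + 1 * (m + (c + (k + k))) + - + 1 * m + d ≡ e + (k + k)
    two-sided m k c d .(c + d) refl = regroup m k c d
      where
      regroup : ∀ m k c d → + 1 * (m + (c + (k + k))) + - + 1 * m + d ≡ c + d + (k + k)
      regroup = solve-∀

    constant : ∀ o z → + ζ o + (if o ∧ z then - + 1 else + 0) ≡ + ζ (o ∧ not z)
    constant false false = refl
    constant false true  = refl
    constant true  false = refl
    constant true  true  = refl

    go : ∀ o a z → evalLinear (linear o ⟨ a , z ⟩) (+ (m ℕ.+ (ζ o ℕ.+ (k ℕ.+ k)))) (+ m)
                 ≡ + (ζ (o ∧ not z) ℕ.+ extent a)
    go o positive  z = one-sided (+ m) (+ k) (+ ζ o) _ _ (constant o z)
    go o negative  z = one-sided (+ m) (+ k) (+ ζ o) _ _ (constant o z)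
    go o symmetric z = two-sided (+ m) (+ k) (+ ζ o) _ _ (constant o z)

  eval-count : ∀ (r : System ν) → eval (poly odd r) (+ l) (+ m) ≡ + count r
  eval-count nil = trans (cong₂ (λ a b → + 1 + a + b) (ℤ.*-zeroʳ (+ m)) (ℤ.*-zeroʳ (+ l))) refl
  eval-count (cons t [] r) =
    trans (eval-timesLinear (linear odd t) (poly odd r) (+ l) (+ m))
    (trans (cong₂ _*_ (evalLinear-size t) (eval-count r))
    (trans (sym (ℤ.pos-* (size t) (count r))) (cong +_ (sym (count-isolated t r)))))
  eval-count (cons t ((j , s) ∷ es) r) =
    trans (eval-subtract (poly odd (cons t es r)) (poly odd (contract j s t es r)) (+ l) (+ m))
    (trans (cong₂ (λ a b → a + - + 1 * b)
             (trans (eval-count (cons t es r)) (cong +_ (count-deletion-contraction j s t es r)))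
             (eval-count (contract j s t es r)))
           (cancel (+ count (cons t ((j , s) ∷ es) r)) (+ count (contract j s t es r))))
    where
    cancel : ∀ a b → a + b + - + 1 * b ≡ a
    cancel = solve-∀

-- Balance and switching

signOf : ℕ → Sign
signOf zero    = plus
signOf (suc m) = minus ⊗ signOf m

2∣⇒signOf : ∀ {m} → 2 ℕ.∣ m → signOf m ≡ plus
2∣⇒signOf (ℕ.divides q refl) = go q
  where
  go : ∀ q → signOf (q ℕ.* 2) ≡ plus
  go zero    = refl
  go (suc q) = trans (⊗-cancel minus (signOf (q ℕ.* 2))) (go q)

signOf⇒2∣ : ∀ m → signOf m ≡ plus → 2 ℕ.∣ m
signOf⇒2∣ zero          eq = 2 ℕ.∣0
signOf⇒2∣ (suc (suc m)) eq =
  ℕ.∣m∣n⇒∣m+n ℕ.∣-refl (signOf⇒2∣ m (trans (sym (⊗-cancel minus (signOf m))) eq))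

module Balance (S : SignedGraph) where

  Vertex : Set
  Vertex = Fin (n S)

  IsPotential : (Vertex → Sign) → Set
  IsPotential τ = ∀ u v s → σ S u v ≡ just s → s ≡ τ u ⊗ τ v

  IsEdge : Vertex × Vertex → Set
  IsEdge (u , v) = Is-just (σ S u v)

  edge : ∀ {u v s} → σ S u v ≡ just s → IsEdge (u , v)
  edge eq = subst Is-just (sym eq) (Maybe.just tt)

  edgeSign : ∀ {u v} → IsEdge (u , v) → ∃ λ s → σ S u v ≡ just s
  edgeSign {u} {v} e with σ S u v | e
  ... | just s | _ = s , refl

  sign : List (Vertex × Vertex) → Sign
  sign ps = signOf (negCount S ps)

  sign-∷ : ∀ {u v s} ps → σ S u v ≡ just s → sign ((u , v) ∷ ps) ≡ s ⊗ sign ps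
  sign-∷ {u} {v} ps eq with isNeg S (u , v) in neg
  sign-∷ {u} {v} ps eq | b with σ S u v
  sign-∷ {u} {v} {plus}  ps refl | false | just plus  = refl
  sign-∷ {u} {v} {minus} ps refl | true  | just minus = refl

  potential⇒balanced : ∀ {τ} → IsPotential τ → Balanced S
  potential⇒balanced {τ} pot []       _               = 2 ℕ.∣0
  potential⇒balanced {τ} pot (x ∷ xs) (_ , _ , edges) =
    signOf⇒2∣ _ (trans (walk x xs x edges) (⊗-self (τ x)))
    where
    -- Along a walk the inner values of τ cancel in pairs. The endpoint w is kept separate from x
    -- for the induction and equals it only for the whole cycle.
    walk : ∀ x xs w → All IsEdge (consecutive ((x ∷ xs) ++ [ w ])) →
      sign (consecutive ((x ∷ xs) ++ [ w ])) ≡ τ x ⊗ τ w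
    walk x [] w (e ∷ []) = let s , eq = edgeSign e in
      trans (sign-∷ [] eq) (trans (⊗-identityʳ s) (pot x w s eq))
    walk x (y ∷ ys) w (e ∷ es) = let s , eq = edgeSign e in
      trans (sign-∷ (consecutive ((y ∷ ys) ++ [ w ])) eq)
      (trans (cong₂ _⊗_ (pot x y s eq) (walk y ys w es))
      (trans (⊗-assoc (τ x) (τ y) (τ y ⊗ τ w)) (cong (τ x ⊗_) (⊗-cancel (τ y) (τ w)))))

  -- Simple paths, indexed by the product of their edge signs and by their vertices; simplicity
  -- supplies the `Unique` part of `IsCycle` once an edge closes the path.
  data Path : Vertex → Vertex → Sign → List Vertex → Set where
    stop : ∀ {u} → Path u u plus [ u ]
    step : ∀ {u v w a b vs} → σ S u v ≡ just a → All (u ≢_) vs → Path v w b vs →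
           Path u w (a ⊗ b) (u ∷ vs)

  path-unique : ∀ {u v a vs} → Path u v a vs → Unique vs
  path-unique stop              = [] ∷ []
  path-unique (step _ fresh p) = fresh ∷ path-unique p

  append : ∀ {u v x y a b s vs ws} → Path u x a vs → σ S x y ≡ just s → Path y v b ws →
    All (λ z → All (z ≢_) ws) vs → Path u v (a ⊗ (s ⊗ b)) (vs ++ ws)
  append stop eq q (d ∷ []) = step eq d q
  append {b = c} {s = s} (step {a = a} {b = b} e fresh p) eq q (d ∷ ds) =
    subst (λ z → Path _ _ z _) (sym (⊗-assoc a b (s ⊗ c)))
      (step e (All.++⁺ fresh d) (append p eq q ds))

  close : ∀ {u v w a b vs} → Path u v a vs → σ S v w ≡ just b →
    All IsEdge (consecutive (vs ++ [ w ])) × sign (consecutive (vs ++ [ w ])) ≡ a ⊗ b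
  close {b = b} stop eq = edge eq ∷ [] , trans (sign-∷ [] eq) (⊗-identityʳ b)
  close {w = w} {b = b} (step {a = a} e fresh stop) eq =
    let es , s = close {w = w} stop eq in edge e ∷ es , trans (sign-∷ _ e)
      (trans (cong (a ⊗_) s) (cong (_⊗ b) (sym (⊗-identityʳ a))))
  close {w = w} {b = b} (step {a = a} {b = c} e fresh p@(step _ _ _)) eq =
    let es , s = close {w = w} p eq in edge e ∷ es , trans (sign-∷ _ e)
      (trans (cong (a ⊗_) s) (sym (⊗-assoc a c b)))

  -- The edge closes the path to a cycle, whose sign is positive by balance. A cycle has at least
  -- three vertices, so short paths are separate: one vertex would give a loop, and a path of one
  -- edge is the given edge itself.
  balanced-path : Balanced S → ∀ {u v a s vs} → Path u v a vs → σ S u v ≡ just s → s ≡ a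
  balanced-path bal stop eq = contradiction (trans (sym eq) (σ-irr S _)) λ ()
  balanced-path bal (step {a = a} e _ stop) eq =
    trans (just-injective (trans (sym eq) e)) (sym (⊗-identityʳ a))
  balanced-path bal {u} {v} {a} {s} p@(step {vs = x ∷ y ∷ vs} _ _ (step _ _ _)) eq =
    let edges , closed = close {w = u} p (trans (σ-sym S v u) eq)
    in sym (⊗≡plus⇒≡ (trans (sym closed)
         (2∣⇒signOf (bal _ (path-unique p , s≤s (s≤s (s≤s z≤n)) , edges)))))

  -- The pairs ps processed so far, with the components they span labelled by c.
  record Forest (ps : List (Vertex × Vertex)) : Set where
    field
      τ          : Vertex → Sign
      c          : Vertex → Vertex
      compatible : All (λ (u , v) → ∀ s → σ S u v ≡ just s → s ≡ τ u ⊗ τ v × c u ≡ c v) ps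
      -- Paths stay inside their component, so that paths in two different components can be joined
      -- by an edge and remain simple.
      path       : ∀ u v → c u ≡ c v →
                   ∃ λ vs → Path u v (τ u ⊗ τ v) vs × All (λ w → c w ≡ c u) vs

  empty : Forest []
  empty = record
    { τ          = λ _ → plus
    ; c          = λ v → v
    ; compatible = []
    ; path       = λ { u .u refl → [ u ] , stop , refl ∷ [] }
    }

  -- The component of i is merged into that of j, multiplying the potential on it by
  -- the sign that makes the new edge compatible.
  module Merge {ps} (F : Forest ps) (i j : Vertex) (s : Sign) (eq : σ S i j ≡ just s)
               (apart : Forest.c F i ≢ Forest.c F j) where
    open Forest F

    x : Sign
    x = s ⊗ (τ i ⊗ τ j)

    -- The decision is an argument, so that a single `with` on the labels reduces both `τ′` and
    -- `c′`.
    flipped : ∀ {v} → Dec (c v ≡ c i) → Sign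
    flipped {v} (yes _) = x ⊗ τ v
    flipped {v} (no _)  = τ v

    merged : ∀ {v} → Dec (c v ≡ c i) → Vertex
    merged     (yes _) = c j
    merged {v} (no _)  = c v

    τ′ : Vertex → Sign
    τ′ v = flipped {v} (c v Fin.≟ c i)

    c′ : Vertex → Vertex
    c′ v = merged {v} (c v Fin.≟ c i)

    ⊗-interchange : ∀ a b → (x ⊗ a) ⊗ (x ⊗ b) ≡ a ⊗ b
    ⊗-interchange a b =
      trans (cong (_⊗ (x ⊗ b)) (⊗-comm x a))
      (trans (⊗-assoc a x (x ⊗ b)) (cong (a ⊗_) (⊗-cancel x b)))

    edge-sign : s ≡ (x ⊗ τ i) ⊗ τ j
    edge-sign = sym (trans (⊗-assoc x (τ i) (τ j))
      (trans (⊗-assoc s (τ i ⊗ τ j) (τ i ⊗ τ j))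
      (trans (cong (s ⊗_) (⊗-self (τ i ⊗ τ j))) (⊗-identityʳ s))))

    -- The left side is the sign of a path from the component of i through the new edge to that of
    -- j, with a and b the potentials at its ends; `cross-sign′` treats the reverse crossing.
    cross-sign : ∀ a b → (a ⊗ τ i) ⊗ (s ⊗ (τ j ⊗ b)) ≡ (x ⊗ a) ⊗ b
    cross-sign a b = trans (lemma a (τ i) s (τ j ⊗ b))
      (trans (cong (λ z → (a ⊗ z) ⊗ (τ j ⊗ b)) (⊗-comm (τ i) s))
      (trans (regroup a (s ⊗ τ i) (τ j) b)
             (cong (λ z → (z ⊗ a) ⊗ b) (⊗-assoc s (τ i) (τ j)))))
      where
      lemma : ∀ a b c d → (a ⊗ b) ⊗ (c ⊗ d) ≡ (a ⊗ (b ⊗ c)) ⊗ d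
      lemma a b c d = trans (sym (⊗-assoc (a ⊗ b) c d)) (cong (_⊗ d) (⊗-assoc a b c))

      regroup : ∀ a b c d → (a ⊗ b) ⊗ (c ⊗ d) ≡ ((b ⊗ c) ⊗ a) ⊗ d
      regroup a b c d = trans (lemma a b c d) (cong (_⊗ d) (⊗-comm a (b ⊗ c)))

    cross-sign′ : ∀ a b → (a ⊗ τ j) ⊗ (s ⊗ (τ i ⊗ b)) ≡ a ⊗ (x ⊗ b)
    cross-sign′ a b = trans (⊗-assoc a (τ j) _) (cong (a ⊗_)
      (trans (sym (⊗-assoc (τ j) s _)) (trans (cong (_⊗ (τ i ⊗ b)) (⊗-comm (τ j) s))
      (trans (⊗-assoc s (τ j) _) (trans (cong (s ⊗_) (trans (sym (⊗-assoc (τ j) (τ i) b))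
        (cong (_⊗ b) (⊗-comm (τ j) (τ i))))) (sym (⊗-assoc s (τ i ⊗ τ j) b)))))))

    merged-yes : ∀ {v} → c v ≡ c i → c′ v ≡ c j
    merged-yes {v} eq with c v Fin.≟ c i
    ... | yes _ = refl
    ... | no ≢  = contradiction eq ≢

    merged-no : ∀ {v} → c v ≢ c i → c′ v ≡ c v
    merged-no {v} ≢ with c v Fin.≟ c i
    ... | yes eq = contradiction eq ≢
    ... | no _   = refl

    compatible′ : ∀ {u v} → (∀ s → σ S u v ≡ just s → s ≡ τ u ⊗ τ v × c u ≡ c v) →
      ∀ s → σ S u v ≡ just s → s ≡ τ′ u ⊗ τ′ v × c′ u ≡ c′ v
    compatible′ {u} {v} h s e with h s e | c u Fin.≟ c i | c v Fin.≟ c i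
    ... | s≡ , _    | yes _    | yes _   = trans s≡ (sym (⊗-interchange (τ u) (τ v))) , refl
    ... | _  , cu≡cv | yes cu≡ | no cv≢  = contradiction (trans (sym cu≡cv) cu≡) cv≢
    ... | _  , cu≡cv | no cu≢  | yes cv≡ = contradiction (trans cu≡cv cv≡) cu≢
    ... | same       | no _    | no _    = same

    new : ∀ s′ → σ S i j ≡ just s′ → s′ ≡ τ′ i ⊗ τ′ j × c′ i ≡ c′ j
    new s′ e with c i Fin.≟ c i | c j Fin.≟ c i
    ... | no ≢  | _        = contradiction refl ≢
    ... | yes _ | yes cj≡ = contradiction (sym cj≡) apart
    ... | yes _ | no _    = trans (just-injective (trans (sym e) eq)) edge-sign , refl

    disjoint : ∀ {a b} {vs ws : List Vertex} → a ≢ b →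
      All (λ w → c w ≡ a) vs → All (λ w → c w ≡ b) ws → All (λ z → All (z ≢_) ws) vs
    disjoint a≢b inA inB = All.map (λ cz≡a → All.map
      (λ cw≡b z≡w → a≢b (trans (sym cz≡a) (trans (cong c z≡w) cw≡b))) inB) inA

    path′ : ∀ u v → c′ u ≡ c′ v → ∃ λ vs → Path u v (τ′ u ⊗ τ′ v) vs × All (λ w → c′ w ≡ c′ u) vs
    path′ u v e with c u Fin.≟ c i | c v Fin.≟ c i
    ... | yes cu | yes cv =
      let vs , p , inU = path u v (trans cu (sym cv))
      in vs , subst (λ z → Path u v z vs) (sym (⊗-interchange (τ u) (τ v))) p ,
         All.map (λ cw → merged-yes (trans cw cu)) inU
    ... | no cu | no cv =
      let vs , p , inU = path u v e
      in vs , p , All.map (λ cw → trans (merged-no (λ cw′ → cu (trans (sym cw) cw′))) cw) inU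
    ... | yes cu | no cv =
      let vs , p , inU = path u i cu
          ws , q , inJ = path j v e
      in vs ++ ws ,
         subst (λ z → Path u v z (vs ++ ws)) (cross-sign (τ u) (τ v))
           (append p eq q (disjoint (λ cu≡cj → apart (trans (sym cu) cu≡cj)) inU inJ)) ,
         All.++⁺ (All.map (λ cw → merged-yes (trans cw cu)) inU)
                 (All.map (λ cw → trans (merged-no (λ cw′ → apart (trans (sym cw′) cw))) cw) inJ)
    ... | no cu | yes cv =
      let vs , p , inU = path u j e
          ws , q , inI = path i v (sym cv)
      in vs ++ ws ,
         subst (λ z → Path u v z (vs ++ ws)) (cross-sign′ (τ u) (τ v))
           (append p (trans (σ-sym S j i) eq) q (disjoint cu inU inI)) ,
         All.++⁺ (All.map (λ cw → trans (merged-no (λ cw′ → cu (trans (sym cw) cw′))) cw) inU)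
                 (All.map (λ cw → trans (merged-yes cw) (sym e)) inI)

    merge : Forest ((i , j) ∷ ps)
    merge = record
      { τ          = τ′
      ; c          = c′
      ; compatible = new ∷ All.map compatible′ compatible
      ; path       = path′
      }

  extend : Balanced S → ∀ {ps} i j → Forest ps → Forest ((i , j) ∷ ps)
  extend bal i j F with σ S i j in eq
  ... | nothing = record
    { Forest F
    ; compatible = (λ s e → contradiction (trans (sym eq) e) λ ()) ∷ Forest.compatible F
    }
  ... | just s with Forest.c F i Fin.≟ Forest.c F j
  ...   | no apart = Merge.merge F i j s eq apart
  ...   | yes same = record
    { Forest F
    ; compatible = (λ s′ e → balanced-path bal (proj₁ (proj₂ (Forest.path F i j same))) e , same)
                   ∷ Forest.compatible F
    }

  forest : Balanced S → ∀ ps → Forest ps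
  forest bal []             = empty
  forest bal ((i , j) ∷ ps) = extend bal i j (forest bal ps)

  balanced⇒potential : Balanced S → ∃ IsPotential
  balanced⇒potential bal = Forest.τ F , λ u v s e →
    proj₁ (All.lookup (Forest.compatible F) (∈-cartesianProduct⁺ (∈-allFin u) (∈-allFin v)) s e)
    where
    F = forest bal (cartesianProduct (allFin (n S)) (allFin (n S)))

-- Colour sets and the graph as a system

∈-select⁺ : ∀ (p : A → Bool) {xs x} → x ∈ xs → p x ≡ true → x ∈ select p xs
∈-select⁺ p = ∈-filter⁺ (λ x → p x Bool.≟ true)

∈-select⁻ : ∀ (p : A → Bool) {xs x} → x ∈ select p xs → x ∈ xs × p x ≡ true
∈-select⁻ p = ∈-filter⁻ (λ x → p x Bool.≟ true)

select-unique : ∀ (p : A → Bool) {xs} → Unique xs → Unique (select p xs)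
select-unique p = Unique.filter⁺ (λ x → p x Bool.≟ true)

isZero-false : ∀ {x} → not (isZero x) ≡ true → x ≢ + 0
isZero-false () refl

≢0⇒isZero-false : ∀ {x} → x ≢ + 0 → not (isZero x) ≡ true
≢0⇒isZero-false {x} x≢0 = cong not (dec-false (x ℤ.≟ + 0) x≢0)

2∤1+k+k : ∀ k → ¬ 2 ℕ.∣ suc (k ℕ.+ k)
2∤1+k+k k 2∣ = contradiction (ℕ.∣⇒≤ (ℕ.∣m+n∣m⇒∣n (subst (2 ℕ.∣_) (ℕ.+-comm 1 (k ℕ.+ k)) 2∣) (2∣k+k k)))
                             (ℕ.<⇒≱ (s≤s (s≤s z≤n)))
  where
  2∣k+k : ∀ k → 2 ℕ.∣ (k ℕ.+ k)
  2∣k+k k = ℕ.divides k (double k)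
    where
    double : ∀ k → k ℕ.+ k ≡ k ℕ.* 2
    double = ℕ-solve-∀

module ColourSet (odd : Bool) (k m : ℕ) where
  open Palette odd k m public

  P⇒ : ∀ {z} → z ∈ P → z ∈ Ω × inC z ≡ true × inC (- z) ≡ true × not (isZero z) ≡ true
  P⇒ {z} z∈ =
    let z∈Ω , eq = ∈-select⁻ inP z∈
        both     = Bool.∧-conicalˡ (inC z ∧ inC (- z)) _ eq
    in z∈Ω , Bool.∧-conicalˡ (inC z) _ both , Bool.∧-conicalʳ (inC z) _ both ,
       Bool.∧-conicalʳ (inC z ∧ inC (- z)) _ eq

  P⇐ : ∀ {z} → z ∈ Ω → inC z ≡ true → inC (- z) ≡ true → not (isZero z) ≡ true → z ∈ P
  P⇐ z∈Ω c c′ nz = ∈-select⁺ inP z∈Ω (cong₂ _∧_ (cong₂ _∧_ c c′) nz)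

  U⇒ : ∀ {z} → z ∈ U → z ∈ Ω × inC z ≡ true × inC (- z) ≡ false
  U⇒ {z} z∈ =
    let z∈Ω , eq = ∈-select⁻ inU z∈
    in z∈Ω , Bool.∧-conicalˡ (inC z) _ eq , Bool.not-injective (Bool.∧-conicalʳ (inC z) _ eq)

  length-P : length P ≡ k ℕ.+ k
  length-P = trans (length-select inP Ω)
    -- `inP` is by computation the test for C ∩ -C without 0.
    (trans (size-⟨⟩ symmetric true) (cong (λ b → ζ b ℕ.+ (k ℕ.+ k)) (Bool.∧-zeroʳ odd)))

  -- U is C without C ∩ -C, so its size follows from the two domain sizes already computed, by
  -- cancellation.
  length-U : length U ≡ m
  length-U = ℕ.+-cancelˡ-≡ (size ⟨ symmetric , false ⟩) (length U) m (begin
    size ⟨ symmetric , false ⟩ ℕ.+ length U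
      ≡⟨ cong (size ⟨ symmetric , false ⟩ ℕ.+_) (length-select inU Ω) ⟩
    size ⟨ symmetric , false ⟩ ℕ.+ ∑ Ω (λ x → ⟦ inU x ⟧)
      ≡⟨ ∑-+ Ω (λ x → ⟦ admits ⟨ symmetric , false ⟩ x ⟧) (λ x → ⟦ inU x ⟧) ⟨
    ∑ Ω (λ x → ⟦ (inC x ∧ inC (- x)) ∧ true ⟧ ℕ.+ ⟦ inC x ∧ not (inC (- x)) ⟧)
      ≡⟨ ∑-cong Ω (λ x _ → split (inC x) (inC (- x))) ⟩
    size ⟨ positive , false ⟩
      ≡⟨ size-⟨⟩ positive false ⟩
    ζ (odd ∧ true) ℕ.+ (m ℕ.+ k ℕ.+ k)
      ≡⟨ regroup (ζ (odd ∧ true)) m k ⟩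
    ζ (odd ∧ true) ℕ.+ (k ℕ.+ k) ℕ.+ m
      ≡⟨ cong (ℕ._+ m) (size-⟨⟩ symmetric false) ⟨
    size ⟨ symmetric , false ⟩ ℕ.+ m ∎)
    where
    open ≡-Reasoning
    split : ∀ a b → ⟦ (a ∧ b) ∧ true ⟧ ℕ.+ ⟦ a ∧ not b ⟧ ≡ ⟦ a ∧ true ⟧
    split false b     = refl
    split true  false = refl
    split true  true  = refl

    regroup : ∀ z m k → z ℕ.+ (m ℕ.+ k ℕ.+ k) ≡ z ℕ.+ (k ℕ.+ k) ℕ.+ m
    regroup = ℕ-solve-∀

  -- Recording `+ 0 ∈ Ω` lets one statement serve both parities: the last alternative is impossible
  -- in the even case and reduces to z = 0 in the odd case.
  C⇔ : ∀ z → z ∈ C ⇔ (z ∈ P ⊎ z ∈ U ⊎ (z ≡ + 0 × + 0 ∈ Ω))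
  C⇔ z = mk⇔ to from
    where
    to : z ∈ C → z ∈ P ⊎ z ∈ U ⊎ (z ≡ + 0 × + 0 ∈ Ω)
    to z∈ with ∈-select⁻ inC z∈ | z ℤ.≟ + 0 | inC (- z) in eq
    ... | z∈Ω , _ | yes refl | _     = inj₂ (inj₂ (refl , z∈Ω))
    ... | z∈Ω , c | no z≢0   | true  = inj₁ (P⇐ z∈Ω c eq (≢0⇒isZero-false z≢0))
    ... | z∈Ω , c | no z≢0   | false = inj₂ (inj₁ (∈-select⁺ inU z∈Ω (cong₂ _∧_ c (cong not eq))))

    from : z ∈ P ⊎ z ∈ U ⊎ (z ≡ + 0 × + 0 ∈ Ω) → z ∈ C
    from (inj₁ z∈)                  = let z∈Ω , c , _ = P⇒ z∈ in ∈-select⁺ inC z∈Ω c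
    from (inj₂ (inj₁ z∈))           = let z∈Ω , c , _ = U⇒ z∈ in ∈-select⁺ inC z∈Ω c
    from (inj₂ (inj₂ (refl , 0∈Ω))) = ∈-select⁺ inC 0∈Ω refl

  l∸m : l ∸ m ≡ ζ odd ℕ.+ (k ℕ.+ k)
  l∸m = ℕ.m+n∸m≡n m (ζ odd ℕ.+ (k ℕ.+ k))

  isColourSet′ :
    ((2 ℕ.∣ (l ∸ m) × length P ≡ l ∸ m × (∀ z → z ∈ C ⇔ (z ∈ P ⊎ z ∈ U)))
    ⊎ (¬ (2 ℕ.∣ (l ∸ m)) × length P ≡ l ∸ m ∸ 1 × (∀ z → z ∈ C ⇔ (z ∈ P ⊎ z ∈ U ⊎ z ≡ + 0)))) →
    IsColourSet l m C
  isColourSet′ rest =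
    select-unique inC Ω-unique , P , U ,
    select-unique inP Ω-unique , select-unique inU Ω-unique ,
    All.tabulate (λ z∈ → isZero-false (proj₂ (proj₂ (proj₂ (P⇒ z∈))))) ,
    -- 0 is its own negative and passes `inC`, so it cannot lie in `U`.
    All.tabulate (λ { z∈ refl → contradiction (proj₂ (proj₂ (U⇒ z∈))) λ () }) ,
    (λ z z∈P z∈U → contradiction (trans (sym (proj₁ (proj₂ (proj₂ (P⇒ z∈P))))) (proj₂ (proj₂ (U⇒ z∈U)))) λ ()) ,
    (λ z z∈P → let z∈Ω , c , c′ , nz = P⇒ z∈P in
      P⇐ (Ω-neg z∈Ω) c′ (trans (cong inC (ℤ.neg-involutive z)) c) (trans (cong not (isZero-neg z)) nz)) ,
    (λ z z∈U -z∈U → contradiction (trans (sym (proj₁ (proj₂ (U⇒ -z∈U)))) (proj₂ (proj₂ (U⇒ z∈U)))) λ ()) ,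
    length-U , rest

0∉mirrored : ∀ M → + 0 ∉ mirrored M
0∉mirrored M 0∈ = proj₁ (∈-mirrored⁻ M 0∈) refl

module _ (k m : ℕ) where

  2∣even-difference : 2 ℕ.∣ (ColourSet.l false k m ∸ m)
  2∣even-difference = ℕ.divides k (trans (ColourSet.l∸m false k m) (double k))
    where
    double : ∀ k → k ℕ.+ k ≡ k ℕ.* 2
    double = ℕ-solve-∀

  2∤odd-difference : ¬ 2 ℕ.∣ (ColourSet.l true k m ∸ m)
  2∤odd-difference 2∣ = 2∤1+k+k k (subst (2 ℕ.∣_) (ColourSet.l∸m true k m) 2∣)

  isColourSet-even : let open ColourSet false k m in IsColourSet l m C
  isColourSet-even = isColourSet′ (inj₁ (2∣even-difference , trans length-P (sym l∸m) , λ z → mk⇔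
    (λ z∈ → case-to z (Equivalence.to (C⇔ z) z∈))
    (λ { (inj₁ z∈) → Equivalence.from (C⇔ z) (inj₁ z∈)
       ; (inj₂ z∈) → Equivalence.from (C⇔ z) (inj₂ (inj₁ z∈)) })))
    where
    open ColourSet false k m
    case-to : ∀ z → z ∈ P ⊎ z ∈ U ⊎ (z ≡ + 0 × + 0 ∈ Ω) → z ∈ P ⊎ z ∈ U
    case-to z (inj₁ z∈)             = inj₁ z∈
    case-to z (inj₂ (inj₁ z∈))      = inj₂ z∈
    case-to z (inj₂ (inj₂ (_ , 0∈))) = contradiction 0∈ (0∉mirrored (m ℕ.+ k))

  isColourSet-odd : let open ColourSet true k m in IsColourSet l m C
  isColourSet-odd = isColourSet′ (inj₂ (2∤odd-difference ,
    trans length-P (sym (cong (_∸ 1) l∸m)) , λ z → mk⇔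
    (λ z∈ → case-to z (Equivalence.to (C⇔ z) z∈))
    (λ { (inj₁ z∈)        → Equivalence.from (C⇔ z) (inj₁ z∈)
       ; (inj₂ (inj₁ z∈)) → Equivalence.from (C⇔ z) (inj₂ (inj₁ z∈))
       ; (inj₂ (inj₂ eq)) → Equivalence.from (C⇔ z) (inj₂ (inj₂ (eq , here refl))) })))
    where
    open ColourSet true k m
    case-to : ∀ z → z ∈ P ⊎ z ∈ U ⊎ (z ≡ + 0 × + 0 ∈ Ω) → z ∈ P ⊎ z ∈ U ⊎ z ≡ + 0
    case-to z (inj₁ z∈)              = inj₁ z∈
    case-to z (inj₂ (inj₁ z∈))       = inj₂ (inj₁ z∈)
    case-to z (inj₂ (inj₂ (eq , _))) = inj₂ (inj₂ eq)

isColourSet : ∀ odd k m → let open ColourSet odd k m in IsColourSet l m C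
isColourSet false = isColourSet-even
isColourSet true  = isColourSet-odd

edgesOf : (A → Maybe Sign) → List A → List (A × Sign)
edgesOf f []       = []
edgesOf f (x ∷ xs) with f x
... | just s  = (x , s) ∷ edgesOf f xs
... | nothing = edgesOf f xs

edgesOf⁺ : ∀ {Q : A × Sign → Set} f xs → (∀ x s → f x ≡ just s → Q (x , s)) → All Q (edgesOf f xs)
edgesOf⁺ f []       q = []
edgesOf⁺ f (x ∷ xs) q with f x in eq
... | just s  = q x s eq ∷ edgesOf⁺ f xs q
... | nothing = edgesOf⁺ f xs q

edgesOf⁻ : ∀ {Q : A × Sign → Set} f xs → All Q (edgesOf f xs) →
  ∀ {x s} → x ∈ xs → f x ≡ just s → Q (x , s)
edgesOf⁻ f (x ∷ xs) q (here refl) eq with f x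
edgesOf⁻ f (x ∷ xs) (q ∷ _) (here refl) refl | just s = q
edgesOf⁻ f (x ∷ xs) q (there x∈) eq with f x
edgesOf⁻ f (x ∷ xs) (_ ∷ q) (there x∈) eq | just s  = edgesOf⁻ f xs q x∈ eq
edgesOf⁻ f (x ∷ xs) q       (there x∈) eq | nothing = edgesOf⁻ f xs q x∈ eq

-- Only pairs i < j are recorded; the others are recovered from symmetry and irreflexivity. Every
-- vertex starts with the domain C unflagged, so loops arise only through contraction.
fromSigns : ∀ n → (Fin n → Fin n → Maybe Sign) → System n
fromSigns zero    f = nil
fromSigns (suc n) f = cons ⟨ positive , false ⟩ (edgesOf (λ j → f zero (suc j)) (allFin n))
                           (fromSigns n (λ i j → f (suc i) (suc j)))

fromSigns-noPositiveLoop : ∀ n f → NoPositiveLoop (fromSigns n f)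
fromSigns-noPositiveLoop zero    f = tt
fromSigns-noPositiveLoop (suc n) f = tt , fromSigns-noPositiveLoop n _

fromSigns-potential : ∀ n f (τ : Fin n → Sign) → (∀ i j s → f i j ≡ just s → s ≡ τ i ⊗ τ j) →
  Potential (fromSigns n f) (tabulate τ)
fromSigns-potential zero    f τ pot = tt
fromSigns-potential (suc n) f τ pot = refl ,
  edgesOf⁺ _ (allFin n) (λ j s eq →
    trans (pot zero (suc j) s eq) (cong (τ zero ⊗_) (sym (lookup∘tabulate (τ ∘ suc) j)))) ,
  fromSigns-potential n _ (τ ∘ suc) (λ i j → pot (suc i) (suc j))

Symmetric Irreflexive : (Fin ν → Fin ν → Maybe Sign) → Set
Symmetric f   = ∀ i j → f i j ≡ f j i
Irreflexive f = ∀ i → f i i ≡ nothing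

fromSigns-potential⁻ : ∀ n f → Symmetric f → Irreflexive f → ∀ {τ} → Potential (fromSigns n f) τ →
  ∀ i j s → f i j ≡ just s → s ≡ lookup τ i ⊗ lookup τ j
fromSigns-potential⁻ (suc n) f f-sym f-irr {a ∷ᵥ τ} (_ , q , w) = λ where
    zero    zero    s eq → contradiction (trans (sym eq) (f-irr zero)) λ ()
    zero    (suc j) s eq → edgesOf⁻ _ (allFin n) q (∈-allFin j) eq
    (suc i) zero    s eq → trans (edgesOf⁻ _ (allFin n) q (∈-allFin i) (trans (f-sym zero (suc i)) eq))
                                 (⊗-comm a (lookup τ i))
    (suc i) (suc j) s eq → fromSigns-potential⁻ n _ (λ i j → f-sym (suc i) (suc j)) (λ i → f-irr (suc i)) w i j s eq

ProperFor : (Fin ν → Fin ν → Maybe Sign) → Vec ℤ ν → Set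
ProperFor f κ = ∀ i j s → f i j ≡ just s → differ (lookup κ i) s (lookup κ j) ≡ true

module _ (odd : Bool) (k m : ℕ) where
  open ColourSet odd k m

  edgesProper⁺ : ∀ (es : Edges ν) x κ →
    All (λ (j , s) → differ x s (lookup κ j) ≡ true) es → edgesProper es x κ ≡ true
  edgesProper⁺ []       x κ []      = refl
  edgesProper⁺ (_ ∷ es) x κ (p ∷ q) = cong₂ _∧_ p (edgesProper⁺ es x κ q)

  edgesProper⁻ : ∀ (es : Edges ν) x κ →
    edgesProper es x κ ≡ true → All (λ (j , s) → differ x s (lookup κ j) ≡ true) es
  edgesProper⁻ []             x κ eq = []
  edgesProper⁻ ((j , s) ∷ es) x κ eq =
    Bool.∧-conicalˡ (differ x s (lookup κ j)) _ eq ∷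
    edgesProper⁻ es x κ (Bool.∧-conicalʳ (differ x s (lookup κ j)) _ eq)

  fromSigns-proper⁺ : ∀ n f κ → allᵥ inC κ ≡ true → ProperFor f κ → proper (fromSigns n f) κ ≡ true
  fromSigns-proper⁺ zero    f []ᵥ      c p = refl
  fromSigns-proper⁺ (suc n) f (x ∷ᵥ κ) c p = cong₂ _∧_
    (trans (Bool.∧-identityʳ (inC x)) (Bool.∧-conicalˡ (inC x) _ c))
    (cong₂ _∧_
      (edgesProper⁺ _ x κ (edgesOf⁺ _ (allFin n) (λ j s → p zero (suc j) s)))
      (fromSigns-proper⁺ n _ κ (Bool.∧-conicalʳ (inC x) _ c) (λ i j → p (suc i) (suc j))))

  fromSigns-proper⁻ : ∀ n f κ → Symmetric f → Irreflexive f → proper (fromSigns n f) κ ≡ true →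
    allᵥ inC κ ≡ true × ProperFor f κ
  fromSigns-proper⁻ zero    f []ᵥ      f-sym f-irr eq = refl , λ ()
  fromSigns-proper⁻ (suc n) f (x ∷ᵥ κ) f-sym f-irr eq =
    cong₂ _∧_ (trans (sym (Bool.∧-identityʳ (inC x))) (Bool.∧-conicalˡ (inC x ∧ true) _ eq)) (proj₁ ih) , λ where
      zero    zero    s e → contradiction (trans (sym e) (f-irr zero)) λ ()
      zero    (suc j) s e → edgesOf⁻ _ (allFin n) first (∈-allFin j) e
      (suc i) zero    s e → trans (differ-sym (lookup κ i) s x)
                              (edgesOf⁻ _ (allFin n) first (∈-allFin i) (trans (f-sym zero (suc i)) e))
      (suc i) (suc j) s e → proj₂ ih i j s e
    where
    rest  = Bool.∧-conicalʳ (inC x ∧ true) _ eq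
    es    = edgesOf (λ j → f zero (suc j)) (allFin n)
    first = edgesProper⁻ es x κ (Bool.∧-conicalˡ (edgesProper es x κ) _ rest)
    ih    = fromSigns-proper⁻ n (λ i j → f (suc i) (suc j)) κ
              (λ i j → f-sym (suc i) (suc j)) (λ i → f-irr (suc i))
              (Bool.∧-conicalʳ (edgesProper es x κ) _ rest)

and-map⁺ : ∀ (f : A → Bool) xs → (∀ x → f x ≡ true) → and (map f xs) ≡ true
and-map⁺ f []       p = refl
and-map⁺ f (x ∷ xs) p = cong₂ _∧_ (p x) (and-map⁺ f xs p)

and-map⁻ : ∀ (f : A → Bool) {xs x} → and (map f xs) ≡ true → x ∈ xs → f x ≡ true
and-map⁻ f {x ∷ xs} eq (here refl) = Bool.∧-conicalˡ (f x) _ eq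
and-map⁻ f {y ∷ xs} eq (there x∈)  = and-map⁻ f (Bool.∧-conicalʳ (f y) _ eq) x∈

-- Interpolation and the equivalence

module Main (S : SignedGraph) where

  system : System (n S)
  system = fromSigns (n S) (σ S)

  -- The test local to properB is not nameable; it is recovered by unification.
  edgeTest : ∀ κ → Σ (Fin (n S) → Fin (n S) → Bool) λ ok →
    properB S κ ≡ and (map (λ u → and (map (λ v → ok u v) (allFin (n S)))) (allFin (n S)))
  edgeTest κ = _ , refl

  edgeTest-just : ∀ κ {u v s} → σ S u v ≡ just s →
    proj₁ (edgeTest κ) u v ≡ differ (lookup κ u) s (lookup κ v)
  edgeTest-just κ {u} {v} eq with σ S u v
  edgeTest-just κ refl | just s = refl

  edgeTest-nothing : ∀ κ {u v} → σ S u v ≡ nothing → proj₁ (edgeTest κ) u v ≡ true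
  edgeTest-nothing κ {u} {v} eq with σ S u v
  edgeTest-nothing κ refl | nothing = refl

  properB⁺ : ∀ κ → ProperFor (σ S) κ → properB S κ ≡ true
  properB⁺ κ p = and-map⁺ _ (allFin (n S)) λ u → and-map⁺ _ (allFin (n S)) λ v → test u v
    where
    test : ∀ u v → proj₁ (edgeTest κ) u v ≡ true
    test u v = go (σ S u v) refl
      where
      go : ∀ e → σ S u v ≡ e → proj₁ (edgeTest κ) u v ≡ true
      go nothing  eq = edgeTest-nothing κ eq
      go (just s) eq = trans (edgeTest-just κ eq) (p u v s eq)

  properB⁻ : ∀ κ → properB S κ ≡ true → ProperFor (σ S) κ
  properB⁻ κ eq u v s e = trans (sym (edgeTest-just κ e))
    (and-map⁻ (proj₁ (edgeTest κ) u)
      (and-map⁻ (λ u → and (map (proj₁ (edgeTest κ) u) (allFin (n S)))) eq (∈-allFin u)) (∈-allFin v))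

  module _ (odd : Bool) (k m : ℕ) where
    open ColourSet odd k m

    proper-system : ∀ κ → allᵥ inC κ ∧ properB S κ ≡ proper system κ
    proper-system κ = Bool.⇔→≡ {z = true} (mk⇔
      (λ eq → fromSigns-proper⁺ odd k m (n S) (σ S) κ (Bool.∧-conicalˡ (allᵥ inC κ) _ eq)
                (properB⁻ κ (Bool.∧-conicalʳ (allᵥ inC κ) _ eq)))
      (λ eq → let c , p = fromSigns-proper⁻ odd k m (n S) (σ S) κ (σ-sym S) (σ-irr S) eq
              in cong₂ _∧_ c (properB⁺ κ p)))

    numColourings-count : numColourings S C ≡ count system
    numColourings-count = begin
      numColourings S C
        ≡⟨ length-select (properB S) (allVecs S C (n S)) ⟩
      ∑ (allVecs S C (n S)) (λ κ → ⟦ properB S κ ⟧)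
        ≡⟨ ∑-allVecs S C (n S) _ ⟩
      ∑ᵥ C (n S) (λ κ → ⟦ properB S κ ⟧)
        ≡⟨ ∑ᵥ-select inC Ω (n S) _ ⟩
      ∑ᵥ Ω (n S) (λ κ → if allᵥ inC κ then ⟦ properB S κ ⟧ else 0)
        ≡⟨ ∑ᵥ-cong Ω (n S) (λ κ _ → trans (if-⟦⟧ (allᵥ inC κ) _) (cong ⟦_⟧ (proper-system κ))) ⟩
      count system ∎
      where open ≡-Reasoning

  -- What `IsEPoly` and `IsOPoly` say about the explicit colour sets, in a form uniform in the
  -- parity; these values already determine the polynomial.
  InterpolatesColourings : Bool → Poly → Set
  InterpolatesColourings odd p = ∀ k m → let open ColourSet odd k m in
    eval p (+ l) (+ m) ≡ + numColourings S C

  interpolates⇒≈P : ∀ odd p → InterpolatesColourings odd p → p ≈P poly odd system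
  interpolates⇒≈P odd p interpolates = agree⇒≈P
    -- This is λ - 1 for μ = m + 1, since `agree⇒≈P` evaluates at successors; the free k makes λ
    -- unbounded within its parity.
    (λ m k → m ℕ.+ (ζ odd ℕ.+ (k ℕ.+ k)))
    (λ m B → B , s≤s (ℕ.≤-trans (ℕ.m≤m+n B B)
                     (ℕ.≤-trans (ℕ.m≤n+m (B ℕ.+ B) (ζ odd)) (ℕ.m≤n+m _ m))))
    p (poly odd system)
    (λ m k → trans (interpolates k (suc m))
             (trans (cong +_ (numColourings-count odd k (suc m)))
                    (sym (Palette.eval-count odd k (suc m) system))))

  even-interpolates : ∀ {E} → IsEPoly S E → InterpolatesColourings false E
  even-interpolates isE k m =
    isE l m (ℕ.m≤m+n m _) (2∣even-difference k m) C (isColourSet false k m)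
    where open ColourSet false k m

  odd-interpolates : ∀ {O} → IsOPoly S O → InterpolatesColourings true O
  odd-interpolates isO k m =
    isO l m (ℕ.m≤m+n m _) (2∤odd-difference k m) C (isColourSet true k m)
    where open ColourSet true k m

  open Balance S

  equal⇒balanced : poly false system ≈P poly true system → Balanced S
  equal⇒balanced eq =
    let values  = parity-cancel (n S) _ _
                    (trans (sym (eval-value false system))
                    -- No colour set has λ = -1, so this value is reached only through equality of
                    -- coefficients.
                    (trans (eval-resp-≈P (poly false system) (poly true system) eq (- + 1) (+ 0))
                           (eval-value true system)))
        τ , pot = value≡⇒potential system (fromSigns-noPositiveLoop (n S) (σ S)) values
    in potential⇒balanced {lookup τ}
         (fromSigns-potential⁻ (n S) (σ S) (σ-sym S) (σ-irr S) pot)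

  balanced⇒equal : Balanced S → poly true system ≡ poly false system
  balanced⇒equal bal = let τ , pot = balanced⇒potential bal in
    potential⇒poly≡ system (fromSigns-potential (n S) (σ S) τ pot)

theorem4p8 : (S : SignedGraph) (E O : Poly) → IsEPoly S E → IsOPoly S O →
    (E ≈P O) ⇔ Balanced S
theorem4p8 S E O isE isO = mk⇔
  (λ E≈O → equal⇒balanced λ i j → trans (sym (E≈ i j)) (trans (E≈O i j) (O≈ i j)))
  (λ bal i j → trans (E≈ i j)
    (trans (cong (λ p → coeff p i j) (sym (balanced⇒equal bal))) (sym (O≈ i j))))
  where
  open Main S
  E≈ : E ≈P poly false system
  E≈ = interpolates⇒≈P false E (even-interpolates {E} isE)

  O≈ : O ≈P poly true system
  O≈ = interpolates⇒≈P true O (odd-interpolates {O} isO)
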